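{- Let $d,\Delta\ge 1$ and let $G$ be a simple graph with maximum degree $\Delta$. Then: (a) $\chi'_d(G)=\lceil \Delta/d\rceil$ if $d$ does not divide $\Delta$, or $d$ is even, or $\Delta=d$; (b) if $d$ is odd and $\Delta=2d$, then $\chi'_d(G)=2$ if and only if every $2d$-regular connected component of $G$ has an even number of vertices, and otherwise $\chi'_d(G)=3$.
   Context: An edge colouring of $G$ with defect $d$ is a colouring of its edges such that each vertex is incident with at most $d$ edges of each colour. $\chi'_d(G)$ is the minimum number of colours in an edge colouring of $G$ with defect $d$. -}

module Defs where

open import Data.Bool using (Bool; true; false; _∧_)
open import Data.Nat using (ℕ; zero; suc; _+_; _∸_; _≤_; _/_; NonZero)
open import Data.Nat.Divisibility using (_∣_)
open import Data.Fin using (Fin; _≟_)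
open import Data.Fin.Subset using (Subset; ∣_∣; _∈_)
open import Data.Vec using (tabulate)
open import Data.Product using (Σ; _×_; ∃)
open import Relation.Binary.PropositionalEquality using (_≡_)
open import Relation.Nullary using (¬_)
open import Relation.Nullary.Decidable using (⌊_⌋)
open import Function.Bundles using (_⇔_)

record Graph (n : ℕ) : Set where
  field
    Adj   : Fin n → Fin n → Bool
    sym   : ∀ u v → Adj u v ≡ Adj v u
    irrfl : ∀ v → Adj v v ≡ false
open Graph public

degree : ∀ {n} → Graph n → Fin n → ℕ
degree G v = ∣ tabulate (λ w → Adj G v w) ∣

MaxDegree : ∀ {n} → Graph n → ℕ → Set
MaxDegree G Δ = (∀ v → degree G v ≤ Δ) × ∃ (λ v → degree G v ≡ Δ)

colourDegree : ∀ {n k} → Graph n → (Fin n → Fin n → Fin k) → Fin n → Fin k → ℕ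
colourDegree G c v i = ∣ tabulate (λ w → Adj G v w ∧ ⌊ c v w ≟ i ⌋) ∣

-- An edge colouring with k colours and defect d: the colour of the edge uv is
-- c u v (= c v u); values of c on non-adjacent pairs are irrelevant.
record DefectColouring {n} (G : Graph n) (d k : ℕ) : Set where
  field
    col      : Fin n → Fin n → Fin k
    col-sym  : ∀ u v → Adj G u v ≡ true → col u v ≡ col v u
    defect   : ∀ v (i : Fin k) → colourDegree G col v i ≤ d

ChiDefect : ∀ {n} → Graph n → ℕ → ℕ → Set
ChiDefect G d k = DefectColouring G d k × (∀ k′ → DefectColouring G d k′ → k ≤ k′)

⌈_/_⌉ : (a b : ℕ) .{{_ : NonZero b}} → ℕ
⌈ a / b ⌉ = (a + (b ∸ 1)) / b

data Reachable {n} (G : Graph n) : Fin n → Fin n → Set where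
  here  : ∀ {v} → Reachable G v v
  step  : ∀ {u v w} → Adj G u v ≡ true → Reachable G v w → Reachable G u w

Even : ℕ → Set
Even m = 2 ∣ m

-- "every 2d-regular connected component of G has an even number of vertices":
-- for every vertex v whose component is r-regular (r = 2d), the vertex set of
-- that component (a subset S of Fin n) has even cardinality.
RegularComponentsEven : ∀ {n} → Graph n → ℕ → Set
RegularComponentsEven {n} G r =
  ∀ (v : Fin n) →
    (∀ w → Reachable G v w → degree G w ≡ r) →
    ∀ (S : Subset n) → (∀ w → (w ∈ S) ⇔ Reachable G v w) → Even ∣ S ∣

{-# OPTIONS --safe #-}
module Submission where

-- All colourings are built by inserting the edges one at a time.
--
-- Two classes, maximum degree at most 2d. Colour the new edge so that a single vertex has excess,
-- that is, d + 1 edges in one class. Flipping an edge of that class passes the excess on to the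
-- other end. Along a trail of such flips that uses each edge at most once, the excess is absorbed,
-- reaches any prescribed neighbour of its source, or is stuck at the source after all its 2d edges
-- were used. So it can be led to any vertex of its component, and is absorbed by one of degree
-- below 2d. If there is none, then the component is 2d-regular, and the handshake lemma applied to
-- the class in excess shows that d times its number of vertices is odd.
--
-- d even, k classes. A new edge uv for which u has room only in class a and v only in class b
-- leaves the graph of classes a and b with maximum degree at most 2d, so these two classes can be
-- redistributed.
--
-- d does not divide Δ, or three classes with Δ = 2d. By Vizing's theorem there is a proper edge
-- colouring with Δ + 1 ≤ kd colours, and the colours are merged in groups of d.

open import Defs
open import Data.Bool as Bool using (Bool; true; false; _∧_; _∨_; not; if_then_else_)
open import Data.Bool.Properties using (∧-zeroʳ; ∨-zeroʳ; ¬-not)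
open import Data.Empty using (⊥; ⊥-elim)
open import Data.Fin using (Fin; zero; suc; _≟_; quotient; remainder; combine)
open import Data.Fin.Permutation.Components using (transpose; transpose-inverse)
open import Data.Fin.Properties using (any?; combine-remQuot)
open import Data.Fin.Subset using (Subset; ∣_∣)
open import Data.Maybe as Maybe using (Maybe; just; nothing; is-just; fromMaybe)
open import Data.Maybe.Properties using (just-injective; ≡-dec)
open import Data.Nat
  using (ℕ; zero; suc; _+_; _*_; _∸_; _/_; _%_; _≤_; _<_; z≤n; s≤s; s≤s⁻¹; NonZero; >-nonZero⁻¹)
open import Data.Nat.DivMod using (m≡m%n+[m/n]*n; m%n<n; m<n*o⇒m/o<n)
open import Data.Nat.Divisibility
  using (_∣_; _∣0; divides; divides-refl; ∣m∣n⇒∣m+n; ∣m+n∣m⇒∣n; ∣m⇒∣m*n; ∣n⇒∣m*n; >⇒∤)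
open import Data.Nat.Induction using (<-wellFounded)
open import Data.Nat.Primality using (prime[2]; euclidsLemma)
open import Data.Nat.Properties hiding (_≟_)
open import Data.Nat.Solver using (module +-*-Solver)
open import Data.Product using (_×_; _,_; ∃; proj₁; proj₂)
open import Data.Sum as Sum using (_⊎_; inj₁; inj₂)
open import Data.Vec using (tabulate; lookup)
open import Data.Vec.Properties using ([]=⇒lookup; lookup⇒[]=; tabulate∘lookup; lookup∘tabulate)
open import Function using (_∘_)
open import Function.Bundles using (_⇔_; mk⇔; Equivalence)
open import Induction.WellFounded using (Acc; acc)
open import Relation.Binary.PropositionalEquality
  using (_≡_; _≢_; refl; trans; cong; cong₂; subst; module ≡-Reasoning)
  renaming (sym to ≡-sym)
open import Relation.Nullary using (¬_; Dec; yes; no; contradiction)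
open import Relation.Nullary.Decidable
  using (⌊_⌋; toSum; dec-true; dec-false; ¬?; _×-dec_; _⊎-dec_)
open import Algebra.Properties.Semiring.Sum +-*-semiring
  using (sum; ∑-distrib-+; ∑-comm; sum-cong-≗; *-distribʳ-sum)

-- Booleans and decisions.

true≢false : true ≢ false
true≢false ()

⌊⌋-true : ∀ {A : Set} (a? : Dec A) → A → ⌊ a? ⌋ ≡ true
⌊⌋-true (yes _) _ = refl
⌊⌋-true (no ¬a) a = contradiction a ¬a

⌊⌋-false : ∀ {A : Set} (a? : Dec A) → ¬ A → ⌊ a? ⌋ ≡ false
⌊⌋-false (yes a) ¬a = contradiction a ¬a
⌊⌋-false (no _)  _  = refl

⌊⌋-sound : ∀ {A : Set} (a? : Dec A) → ⌊ a? ⌋ ≡ true → A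
⌊⌋-sound (yes a) _ = a

true-iff⇒≡ : ∀ {a b : Bool} → (a ≡ true → b ≡ true) → (b ≡ true → a ≡ true) → a ≡ b
true-iff⇒≡ {false} {false} f g = refl
true-iff⇒≡ {false} {true}  f g = g refl
true-iff⇒≡ {true}  {b}     f g = ≡-sym (f refl)

-- Counting

𝟙 : Bool → ℕ
𝟙 false = 0
𝟙 true  = 1

𝟙-mono : ∀ {a b} → (a ≡ true → b ≡ true) → 𝟙 a ≤ 𝟙 b
𝟙-mono {false} f = z≤n
𝟙-mono {true}  f rewrite f refl = ≤-refl

count : ∀ {n} → (Fin n → Bool) → ℕ
count p = ∣ tabulate p ∣

count≡sum : ∀ {n} (p : Fin n → Bool) → count p ≡ sum (𝟙 ∘ p)
count≡sum {zero}  p = refl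
count≡sum {suc n} p with p zero
... | true  = cong suc (count≡sum (p ∘ suc))
... | false = count≡sum (p ∘ suc)

sum-mono : ∀ {n} {f g : Fin n → ℕ} → (∀ i → f i ≤ g i) → sum f ≤ sum g
sum-mono {zero}  f≤g = z≤n
sum-mono {suc n} f≤g = +-mono-≤ (f≤g zero) (sum-mono (f≤g ∘ suc))

-- The additive form avoids truncated subtraction when a single summand changes.
sum-update : ∀ {n} {f g : Fin n → ℕ} j → (∀ i → i ≢ j → f i ≡ g i) → sum f + g j ≡ sum g + f j
sum-update {suc n} {f} {g} zero f≡g
  rewrite sum-cong-≗ {x = f ∘ suc} {g ∘ suc} (λ i → f≡g (suc i) (λ ())) =
  solve 3 (λ a b s → (a :+ s) :+ b := (b :+ s) :+ a) refl (f zero) (g zero) (sum (g ∘ suc))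
  where open +-*-Solver
sum-update {suc n} {f} {g} (suc j) f≡g rewrite f≡g zero (λ ()) = begin
  g zero + sum (f ∘ suc) + g (suc j)    ≡⟨ +-assoc (g zero) _ _ ⟩
  g zero + (sum (f ∘ suc) + g (suc j))
    ≡⟨ cong (g zero +_) (sum-update j (λ i i≢j → f≡g (suc i) (λ { refl → i≢j refl }))) ⟩
  g zero + (sum (g ∘ suc) + f (suc j))  ≡⟨ +-assoc (g zero) _ _ ⟨
  g zero + sum (g ∘ suc) + f (suc j)    ∎
  where open ≡-Reasoning

sum-mono-< : ∀ {n} {f g : Fin n → ℕ} → (∀ i → f i ≤ g i) → ∀ j → f j < g j → sum f < sum g
sum-mono-< {suc n} f≤g zero    fj<gj = +-mono-<-≤ fj<gj (sum-mono (f≤g ∘ suc))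
sum-mono-< {suc n} f≤g (suc j) fj<gj = +-mono-≤-< (f≤g zero) (sum-mono-< (f≤g ∘ suc) j fj<gj)

sum-const : ∀ n c → sum {n} (λ _ → c) ≡ n * c
sum-const zero    c = refl
sum-const (suc n) c = cong (c +_) (sum-const n c)

count-mono : ∀ {n} {p q : Fin n → Bool} → (∀ i → p i ≡ true → q i ≡ true) → count p ≤ count q
count-mono {p = p} {q} p⇒q rewrite count≡sum p | count≡sum q = sum-mono (λ i → 𝟙-mono (p⇒q i))

count-cong : ∀ {n} {p q : Fin n → Bool} → (∀ i → p i ≡ q i) → count p ≡ count q
count-cong p≡q = ≤-antisym (count-mono (λ i → trans (≡-sym (p≡q i)))) (count-mono (λ i → trans (p≡q i)))

count-remove : ∀ {n} {p q : Fin n → Bool} j → p j ≡ true → q j ≡ false →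
               (∀ i → i ≢ j → p i ≡ q i) → count p ≡ suc (count q)
count-remove {p = p} {q} j pj qj p≡q
  with eq ← sum-update {f = 𝟙 ∘ p} {𝟙 ∘ q} j (λ i i≢j → cong 𝟙 (p≡q i i≢j))
  rewrite count≡sum p | count≡sum q | pj | qj = begin
  sum (𝟙 ∘ p)      ≡⟨ +-identityʳ _ ⟨
  sum (𝟙 ∘ p) + 0  ≡⟨ eq ⟩
  sum (𝟙 ∘ q) + 1  ≡⟨ +-comm _ 1 ⟩
  suc (sum (𝟙 ∘ q)) ∎
  where open ≡-Reasoning

count-mono-< : ∀ {n} {p q : Fin n → Bool} → (∀ i → p i ≡ true → q i ≡ true) →
               ∀ j → p j ≡ false → q j ≡ true → count p < count q
count-mono-< {p = p} {q} p⇒q j pj qj rewrite count≡sum p | count≡sum q =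
  sum-mono-< (λ i → 𝟙-mono (p⇒q i)) j (subst (_< 𝟙 (q j)) (≡-sym (cong 𝟙 pj)) (subst (λ b →
      0 < 𝟙 b) (≡-sym qj) (s≤s z≤n)))

count-none : ∀ {n} {p : Fin n → Bool} → (∀ i → p i ≡ false) → count p ≡ 0
count-none {n} {p} p≡f = trans (count≡sum p) (trans (sum-cong-≗ (λ i → cong 𝟙 (p≡f i)))
    (trans (sum-const n 0) (*-zeroʳ n)))

count-singleton : ∀ {n} (j : Fin n) → count (λ i → ⌊ j ≟ i ⌋) ≡ 1
count-singleton {n} j = trans (count-remove {q = λ _ → false} j (⌊⌋-true (j ≟ j) refl) refl off)
    (cong suc (count-none {n} (λ _ → refl)))
  where
  off : ∀ i → i ≢ j → ⌊ j ≟ i ⌋ ≡ false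
  off i i≢j with j ≟ i
  ... | yes j≡i = contradiction (≡-sym j≡i) i≢j
  ... | no _    = refl

-- The pointwise inequality says at once that `p` and `q` are disjoint and that both lie in `r`.
count-disjoint : ∀ {n} {p q r : Fin n → Bool} → (∀ i → 𝟙 (p i) + 𝟙 (q i) ≤ 𝟙 (r i)) →
    count p + count q ≤ count r
count-disjoint {p = p} {q} {r} h rewrite count≡sum p | count≡sum q | count≡sum r =
  ≤-trans (≤-reflexive (≡-sym (∑-distrib-+ (𝟙 ∘ p) (𝟙 ∘ q)))) (sum-mono h)

count-cover : ∀ {n} {p q r : Fin n → Bool} → (∀ i → 𝟙 (r i) ≤ 𝟙 (p i) + 𝟙 (q i)) → count r ≤ count p + count q
count-cover {p = p} {q} {r} h rewrite count≡sum p | count≡sum q | count≡sum r =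
  ≤-trans (sum-mono h) (≤-reflexive (∑-distrib-+ (𝟙 ∘ p) (𝟙 ∘ q)))

count-unique : ∀ {n} {p : Fin n → Bool} → (∀ i j → p i ≡ true → p j ≡ true → i ≡ j) → count p ≤ 1
count-unique {p = p} uniq with any? (λ i → p i Bool.≟ true)
... | yes (i , pi) = ≤-trans (count-mono (λ j pj → ⌊⌋-true (i ≟ j) (uniq i j pi pj)))
    (≤-reflexive (count-singleton i))
... | no none      = ≤-trans (≤-reflexive (count-none (λ i → ¬-not (λ pi → none (i , pi))))) z≤n

count-pos : ∀ {n} {p : Fin n → Bool} i → p i ≡ true → 1 ≤ count p
count-pos {n} {p} i pi = subst (_≤ count p) (count-singleton i) (count-mono (λ j e →
    subst (λ j → p j ≡ true) (⌊⌋-sound (i ≟ j) e) pi))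

count-pos⁻ : ∀ {n} {p : Fin n → Bool} → 1 ≤ count p → ∃ λ i → p i ≡ true
count-pos⁻ {p = p} 1≤ with any? (λ i → p i Bool.≟ true)
... | yes r   = r
... | no none = contradiction (subst (1 ≤_) (count-none (λ i → ¬-not (λ pi → none (i , pi)))) 1≤) (λ ())

add : ∀ {n} → Fin n → (Fin n → Bool) → Fin n → Bool
add y S w = if ⌊ y ≟ w ⌋ then true else S w

module _ {n : ℕ} (y : Fin n) (S : Fin n → Bool) where

  add-new : add y S y ≡ true
  add-new rewrite ⌊⌋-true (y ≟ y) refl = refl

  add-old : ∀ {w} → S w ≡ true → add y S w ≡ true
  add-old {w} Sw with y ≟ w
  ... | yes _ = refl
  ... | no  _ = Sw

  add-inv : ∀ {w} → add y S w ≡ true → y ≡ w ⊎ S w ≡ true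
  add-inv {w} e with y ≟ w
  ... | yes y≡w = inj₁ y≡w
  ... | no  _   = inj₂ e

  -- The shrinking complement is the termination measure for growing a component, following a path
  -- and extending a fan.
  add-smaller : S y ≡ false → count (not ∘ add y S) < count (not ∘ S)
  add-smaller ¬Sy = count-mono-< shrink y (cong not add-new) (cong not ¬Sy)
    where
    shrink : ∀ w → not (add y S w) ≡ true → not (S w) ≡ true
    shrink w e with y ≟ w
    ... | no _ = e

-- Splitting off the first vertex leaves its row and its column, which have equal sums by symmetry,
-- and a smaller matrix of the same kind; the diagonal contributes nothing. The inner induction runs
-- over numerical matrices.
handshake : ∀ {n} (R : Fin n → Fin n → Bool) → (∀ x y → R x y ≡ R y x) → (∀ x → R x x ≡ false) →
            Even (sum (λ x → count (R x)))
handshake R R-sym R-irrefl = subst Even (sum-cong-≗ (λ x → ≡-sym (count≡sum (R x))))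
  (go (λ x y → 𝟙 (R x y)) (λ x y → cong 𝟙 (R-sym x y)) (λ x → cong 𝟙 (R-irrefl x)))
  where
  go : ∀ {n} (f : Fin n → Fin n → ℕ) → (∀ x y → f x y ≡ f y x) → (∀ x → f x x ≡ 0) →
       Even (sum (λ x → sum (f x)))
  go {zero}  f f-sym f-diag = 2 ∣0
  go {suc n} f f-sym f-diag = subst Even (≡-sym eq) (∣m∣n⇒∣m+n (divides-refl s) (go (λ x y →
      f (suc x) (suc y)) (λ x y → f-sym (suc x) (suc y)) (λ x → f-diag (suc x))))
    where
    s = sum (λ y → f zero (suc y))
    t = sum (λ x → sum (λ y → f (suc x) (suc y)))
    open ≡-Reasoning
    open +-*-Solver
    eq : sum (λ x → sum (f x)) ≡ s * 2 + t
    eq = begin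
      f zero zero + s + sum (λ x → f (suc x) zero + sum (λ y → f (suc x) (suc y)))
        ≡⟨ cong₂ (λ a b → a + s + b) (f-diag zero) (∑-distrib-+ (λ x → f (suc x) zero) _) ⟩
      s + (sum (λ x → f (suc x) zero) + t)
        ≡⟨ cong (λ r → s + (r + t)) (sum-cong-≗ (λ x → f-sym (suc x) zero)) ⟩
      s + (s + t)
        ≡⟨ solve 2 (λ s t → s :+ (s :+ t) := s :* con 2 :+ t) refl s t ⟩
      s * 2 + t ∎

-- Graphs and edge colourings

SameEdge : ∀ {n} → Fin n → Fin n → Fin n → Fin n → Set
SameEdge u v x y = (x ≡ u × y ≡ v) ⊎ (x ≡ v × y ≡ u)

sameEdge? : ∀ {n} (u v x y : Fin n) → Dec (SameEdge u v x y)
sameEdge? u v x y = ((x ≟ u) ×-dec (y ≟ v)) ⊎-dec ((x ≟ v) ×-dec (y ≟ u))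

sameEdge-sym : ∀ {n} {u v x y : Fin n} → SameEdge u v x y → SameEdge u v y x
sameEdge-sym (inj₁ (p , q)) = inj₂ (q , p)
sameEdge-sym (inj₂ (p , q)) = inj₁ (q , p)

sameEdge-unique : ∀ {n} {u v x y z : Fin n} → SameEdge u v x y → SameEdge u v x z → y ≡ z
sameEdge-unique (inj₁ (_    , refl)) (inj₁ (_    , refl)) = refl
sameEdge-unique (inj₁ (refl , refl)) (inj₂ (refl , refl)) = refl
sameEdge-unique (inj₂ (refl , refl)) (inj₁ (refl , refl)) = refl
sameEdge-unique (inj₂ (_    , refl)) (inj₂ (_    , refl)) = refl

module _ {n : ℕ} {A : Set} where

  -- Serves to delete, insert and recolour an edge alike, in adjacency matrices as well as in
  -- colourings.
  override : Fin n → Fin n → A → (Fin n → Fin n → A) → Fin n → Fin n → A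
  override u v a f x y = if ⌊ sameEdge? u v x y ⌋ then a else f x y

  module _ {u v : Fin n} {a : A} (f : Fin n → Fin n → A) where

    override-on : ∀ {x y} → SameEdge u v x y → override u v a f x y ≡ a
    override-on {x} {y} e rewrite ⌊⌋-true (sameEdge? u v x y) e = refl

    override-off : ∀ {x y} → ¬ SameEdge u v x y → override u v a f x y ≡ f x y
    override-off {x} {y} ¬e with sameEdge? u v x y
    ... | yes e = contradiction e ¬e
    ... | no _  = refl

    override-sym : (∀ x y → f x y ≡ f y x) → ∀ x y → override u v a f x y ≡ override u v a f y x
    override-sym f-sym x y with sameEdge? u v x y
    ... | yes e = ≡-sym (override-on (sameEdge-sym e))
    ... | no ¬e = trans (f-sym x y) (≡-sym (override-off (¬e ∘ sameEdge-sym)))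

delete : ∀ {n} → Graph n → Fin n → Fin n → Graph n
delete G u v .Adj     = override u v false (Adj G)
delete G u v .sym     = override-sym (Adj G) (Graph.sym G)
delete G u v .irrfl x with sameEdge? u v x x
... | yes _ = refl
... | no  _ = Graph.irrfl G x

Edgeless : ∀ {n} → Graph n → Set
Edgeless G = ∀ x y → Adj G x y ≡ false

_⊆ᴳ_ : ∀ {n} → Graph n → Graph n → Set
H ⊆ᴳ G = ∀ x y → Adj H x y ≡ true → Adj G x y ≡ true

module _ {n : ℕ} (G : Graph n) where

  adjacent⇒≢ : ∀ {u v} → Adj G u v ≡ true → u ≢ v
  adjacent⇒≢ {u} uv refl = true≢false (trans (≡-sym uv) (Graph.irrfl G u))

  adjacent-sym : ∀ {u v} → Adj G u v ≡ true → Adj G v u ≡ true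
  adjacent-sym {u} {v} = trans (Graph.sym G v u)

  adjacent-sameEdge : ∀ {u v x y} → Adj G u v ≡ true → SameEdge u v x y → Adj G x y ≡ true
  adjacent-sameEdge uv (inj₁ (refl , refl)) = uv
  adjacent-sameEdge uv (inj₂ (refl , refl)) = adjacent-sym uv

  delete-⊆ : ∀ {u v} → delete G u v ⊆ᴳ G
  delete-⊆ {u} {v} x y e with sameEdge? u v x y
  ... | no _ = e

  degree-delete : ∀ {u v x y} → Adj G u v ≡ true → SameEdge u v x y →
      degree G x ≡ suc (degree (delete G u v) x)
  degree-delete {u} {v} {x} {y} uv e = count-remove y (adjacent-sameEdge uv e) (override-on (Adj G) e)
    (λ z z≢y → ≡-sym (override-off (Adj G) (λ e′ → z≢y (sameEdge-unique e′ e))))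

  reachable-trans : ∀ {x y z} → Reachable G x y → Reachable G y z → Reachable G x z
  reachable-trans here        q = q
  reachable-trans (step e p)  q = step e (reachable-trans p q)

  closed-reachable : ∀ {P : Fin n → Set} → (∀ {x y} → P x → Adj G x y ≡ true → P y) →
                     ∀ {x y} → P x → Reachable G x y → P y
  closed-reachable closed px here       = px
  closed-reachable closed px (step e p) = closed-reachable closed (closed px e) p

  -- Starting from `v`, adjacent vertices are added until the set is closed. This turns reachability
  -- into a decidable set.
  component : ∀ v → ∃ λ (S : Fin n → Bool) →
    (∀ w → S w ≡ true → Reachable G v w) × (∀ w → Reachable G v w → S w ≡ true)
  component v = grow (λ w → ⌊ v ≟ w ⌋) (<-wellFounded _) (⌊⌋-true (v ≟ v) refl)
                     (λ w e → subst (Reachable G v) (⌊⌋-sound (v ≟ w) e) here)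
    where
    grow : ∀ S → Acc _<_ (count (not ∘ S)) → S v ≡ true → (∀ w → S w ≡ true → Reachable G v w) →
        ∃ λ (S : Fin n → Bool) →
      (∀ w → S w ≡ true → Reachable G v w) × (∀ w → Reachable G v w → S w ≡ true)
    grow S (acc rec) Sv sound
      with any? (λ x → any? (λ y → (S x Bool.≟ true) ×-dec ((Adj G x y Bool.≟ true) ×-dec
          (S y Bool.≟ false))))
    ... | no closed = S , sound , λ w → closed-reachable closed′ Sv
      where
      closed′ : ∀ {x y} → S x ≡ true → Adj G x y ≡ true → S y ≡ true
      closed′ {x} {y} Sx xy = ¬-not (λ Sy → closed (x , y , Sx , xy , Sy))
    ... | yes (x , y , Sx , xy , ¬Sy) =
      grow (add y S) (rec (add-smaller y S ¬Sy)) (add-old y S Sv) λ w e → sound′ w (add-inv y S e)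
      where
      sound′ : ∀ w → y ≡ w ⊎ S w ≡ true → Reachable G v w
      sound′ w (inj₁ refl) = reachable-trans (sound x Sx) (step xy here)
      sound′ w (inj₂ Sw)   = sound w Sw

degree-⊆ : ∀ {n} {H G : Graph n} → H ⊆ᴳ G → ∀ v → degree H v ≤ degree G v
degree-⊆ H⊆G v = count-mono (H⊆G v)

-- The degree sum drops with every deletion. The uses below put `H ⊆ᴳ G` into `P H`, so that bounds
-- on `G` pass to every intermediate graph.
edge-induction : ∀ {n} (P : Graph n → Set) → (∀ G → Edgeless G → P G) →
  (∀ G u v → Adj G u v ≡ true → P (delete G u v) → P G) → ∀ G → P G
edge-induction {n} P base insert G = go G (<-wellFounded _)
  where
  go : ∀ G → Acc _<_ (sum (degree G)) → P G
  go G (acc rec) with any? (λ u → any? (λ v → Adj G u v Bool.≟ true))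
  ... | no none = base G (λ x y → ¬-not (λ xy → none (x , y , xy)))
  ... | yes (u , v , uv) = insert G u v uv (go (delete G u v)
    (rec (sum-mono-< (degree-⊆ {H = delete G u v} {G} (delete-⊆ G)) u
        (≤-reflexive (≡-sym (degree-delete G uv (inj₁ (refl , refl))))))))

-- Partial colourings and their classes.

hasColour : ∀ {k} → Maybe (Fin k) → Fin k → Bool
hasColour nothing  i = false
hasColour (just j) i = ⌊ j ≟ i ⌋

hasColour-sound : ∀ {k} {m : Maybe (Fin k)} {i} → hasColour m i ≡ true → m ≡ just i
hasColour-sound {m = just j} {i} e = cong just (⌊⌋-sound (j ≟ i) e)

hasColour-complete : ∀ {k} {m : Maybe (Fin k)} {i} → m ≡ just i → hasColour m i ≡ true
hasColour-complete {i = i} refl = ⌊⌋-true (i ≟ i) refl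

hasColour-other : ∀ {k} {m : Maybe (Fin k)} {i} → m ≢ just i → hasColour m i ≡ false
hasColour-other m≢i = ¬-not (m≢i ∘ hasColour-sound)

sum-hasColour : ∀ {k} (m : Maybe (Fin k)) → sum (λ i → 𝟙 (hasColour m i)) ≡ 𝟙 (is-just m)
sum-hasColour {k} nothing  = trans (sum-const k 0) (*-zeroʳ k)
sum-hasColour     (just j) = trans (≡-sym (count≡sum (λ i → ⌊ j ≟ i ⌋))) (count-singleton j)

classDegree : ∀ {n k} → (Fin n → Fin n → Maybe (Fin k)) → Fin n → Fin k → ℕ
classDegree f v i = count (λ w → hasColour (f v w) i)

-- Double counting of the coloured edges at `v`, sorted by colour on the left.
sum-classDegree : ∀ {n k} (f : Fin n → Fin n → Maybe (Fin k)) v →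
                  sum (classDegree f v) ≡ count (λ w → is-just (f v w))
sum-classDegree {n} {k} f v = begin
  sum (classDegree f v)
    ≡⟨ sum-cong-≗ (λ i → count≡sum (λ w → hasColour (f v w) i)) ⟩
  sum (λ i → sum (λ w → 𝟙 (hasColour (f v w) i)))    ≡⟨ ∑-comm (λ i w → 𝟙 (hasColour (f v w) i)) ⟩
  sum (λ w → sum (λ i → 𝟙 (hasColour (f v w) i)))    ≡⟨ sum-cong-≗ (λ w → sum-hasColour (f v w)) ⟩
  sum (λ w → 𝟙 (is-just (f v w)))                    ≡⟨ count≡sum (λ w → is-just (f v w)) ⟨
  count (λ w → is-just (f v w))                      ∎
  where open ≡-Reasoning

module _ {n k : ℕ} {u v : Fin n} (f : Fin n → Fin n → Maybe (Fin k)) where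

  classDegree-gain : ∀ {x y i} → SameEdge u v x y → f x y ≢ just i →
                     classDegree (override u v (just i) f) x i ≡ suc (classDegree f x i)
  classDegree-gain {y = y} e f≢i = count-remove y (hasColour-complete (override-on f e)) (hasColour-other f≢i)
    (λ z z≢y → cong (λ m → hasColour m _) (override-off f (λ e′ → z≢y (sameEdge-unique e′ e))))

  classDegree-lose : ∀ {x y i m} → SameEdge u v x y → f x y ≡ just i → m ≢ just i →
                     classDegree f x i ≡ suc (classDegree (override u v m f) x i)
  classDegree-lose {y = y} e f≡i m≢i = count-remove y (hasColour-complete f≡i)
    (hasColour-other (λ o≡i → m≢i (trans (≡-sym (override-on f e)) o≡i)))
    (λ z z≢y → ≡-sym (cong (λ m → hasColour m _) (override-off f (λ e′ → z≢y (sameEdge-unique e′ e)))))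

  classDegree-keep : ∀ {x i m} → (∀ y → SameEdge u v x y → hasColour m i ≡ hasColour (f x y) i) →
                     classDegree (override u v m f) x i ≡ classDegree f x i
  classDegree-keep {x} {i} {m} same = count-cong keep
    where
    keep : ∀ z → hasColour (override u v m f x z) i ≡ hasColour (f x z) i
    keep z with sameEdge? u v x z
    ... | yes e = same z e
    ... | no _  = refl

-- `nothing` marks exactly the non-edges, so class sizes can be counted without mentioning
-- adjacency.
record EdgeColouring {n} (G : Graph n) (k : ℕ) : Set where
  field
    colour     : Fin n → Fin n → Maybe (Fin k)
    colour-sym : ∀ x y → colour x y ≡ colour y x
    support    : ∀ x y → is-just (colour x y) ≡ Adj G x y

  coloured⇒adjacent : ∀ {x y i} → colour x y ≡ just i → Adj G x y ≡ true
  coloured⇒adjacent {x} {y} e = trans (≡-sym (support x y)) (cong is-just e)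

  adjacent⇒coloured : ∀ {x y} → Adj G x y ≡ true → ∃ λ i → colour x y ≡ just i
  adjacent⇒coloured {x} {y} e with colour x y | support x y
  ... | just i  | _ = i , refl
  ... | nothing | s = contradiction (trans s e) (λ ())

  nonadjacent⇒uncoloured : ∀ {x y} → Adj G x y ≡ false → colour x y ≡ nothing
  nonadjacent⇒uncoloured {x} {y} e with colour x y | support x y
  ... | just i  | s = contradiction (trans s e) (λ ())
  ... | nothing | _ = refl

  colour-sameEdge : ∀ {u v x y} → SameEdge u v x y → colour x y ≡ colour u v
  colour-sameEdge (inj₁ (refl , refl)) = refl
  colour-sameEdge (inj₂ (refl , refl)) = colour-sym _ _

  sum-classDegree≡degree : ∀ v → sum (classDegree colour v) ≡ degree G v
  sum-classDegree≡degree v = trans (sum-classDegree colour v) (count-cong (support v))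
open EdgeColouring public

HasDefect : ∀ {n k} {G : Graph n} → EdgeColouring G k → ℕ → Set
HasDefect c d = ∀ v i → classDegree (colour c) v i ≤ d

Colourable : ∀ {n} → Graph n → ℕ → ℕ → Set
Colourable G k d = ∃ λ (c : EdgeColouring G k) → HasDefect c d

emptyColouring : ∀ {n k} {G : Graph n} → Edgeless G → EdgeColouring G k
emptyColouring edgeless .colour     x y = nothing
emptyColouring edgeless .colour-sym x y = refl
emptyColouring edgeless .support    x y = ≡-sym (edgeless x y)

emptyColouring-defect : ∀ {n k} {G : Graph n} (e : Edgeless G) d → HasDefect (emptyColouring {k = k} {G} e) d
emptyColouring-defect {n} e d v i = ≤-trans (≤-reflexive (count-none {n} (λ _ → refl))) z≤n

recolour : ∀ {n k} {G : Graph n} → EdgeColouring G k → ∀ {u v} → Adj G u v ≡ true → Fin k → EdgeColouring G k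
recolour c {u} {v} uv i .colour = override u v (just i) (colour c)
recolour c uv i .colour-sym     = override-sym (colour c) (colour-sym c)
recolour {G = G} c {u} {v} uv i .support x y with sameEdge? u v x y
... | yes e = ≡-sym (adjacent-sameEdge G uv e)
... | no  _ = support c x y

colourDeleted : ∀ {n k} {G : Graph n} {u v} → Adj G u v ≡ true → EdgeColouring (delete G u v) k →
    Fin k → EdgeColouring G k
colourDeleted {u = u} {v} uv c i .colour = override u v (just i) (colour c)
colourDeleted uv c i .colour-sym     = override-sym (colour c) (colour-sym c)
colourDeleted {G = G} {u} {v} uv c i .support x y with sameEdge? u v x y | support c x y
... | yes e | _ = ≡-sym (adjacent-sameEdge G uv e)
... | no  _ | s = s

deleted-uncoloured : ∀ {n k} {G : Graph n} {u v} (c : EdgeColouring (delete G u v) k) →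
                     ∀ {x y} → SameEdge u v x y → colour c x y ≡ nothing
deleted-uncoloured {G = G} c e = nonadjacent⇒uncoloured c (override-on (Adj G) e)

-- Two classes

other : Fin 2 → Fin 2
other zero       = suc zero
other (suc zero) = zero

other-≢ : ∀ b → other b ≢ b
other-≢ zero       ()
other-≢ (suc zero) ()

same-or-other : ∀ b b′ → b′ ≡ b ⊎ b′ ≡ other b
same-or-other zero       zero       = inj₁ refl
same-or-other zero       (suc zero) = inj₂ refl
same-or-other (suc zero) zero       = inj₂ refl
same-or-other (suc zero) (suc zero) = inj₁ refl

sum-two : ∀ (f : Fin 2 → ℕ) b → f b + f (other b) ≡ sum f
sum-two f zero       = cong (f zero +_) (≡-sym (+-identityʳ _))
sum-two f (suc zero) = trans (+-comm (f (suc zero)) _) (cong (f zero +_) (≡-sym (+-identityʳ _)))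

module TwoColours {n : ℕ} (G : Graph n) (d : ℕ) (degree≤ : ∀ v → degree G v ≤ 2 * d) where

  classSize : EdgeColouring G 2 → Fin n → Fin 2 → ℕ
  classSize c = classDegree (colour c)

  classSizes : ∀ c v b → classSize c v b + classSize c v (other b) ≡ degree G v
  classSizes c v b = trans (sum-two (classSize c v) b) (sum-classDegree≡degree c v)

  degree≤d+d : ∀ v → degree G v ≤ d + d
  degree≤d+d v = subst (degree G v ≤_) (cong (d +_) (+-identityʳ d)) (degree≤ v)

  -- The two class sizes add up to `2 * d` and neither exceeds `d`.
  saturated : ∀ c {x b} → degree G x ≡ 2 * d → classSize c x b ≤ d → classSize c x (other b) ≤ d →
      classSize c x b ≡ d
  saturated c {x} {b} full le le′ = ≤-antisym le (+-cancelʳ-≤ d _ _ (≤-trans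
    (≤-reflexive (≡-sym (trans (classSizes c x b) (trans full (cong (d +_) (+-identityʳ d))))))
    (+-monoʳ-≤ _ le′)))

  record Excess (c : EdgeColouring G 2) (w : Fin n) (b : Fin 2) : Set where
    field
      at        : classSize c w b ≡ suc d
      elsewhere : ∀ v b′ → v ≢ w → classSize c v b′ ≤ d

    deficient : classSize c w (other b) < d
    deficient = +-cancelˡ-≤ d _ _ (subst (_≤ d + d) (trans (cong (_+ classSize c w (other b)) at)
        (≡-sym (+-suc d _)))
      (≤-trans (≤-reflexive (classSizes c w b)) (degree≤d+d w)))

    at≤ : ∀ b′ → classSize c w b′ ≤ suc d
    at≤ b′ with same-or-other b b′
    ... | inj₁ refl = ≤-reflexive at
    ... | inj₂ refl = ≤-trans (<⇒≤ deficient) (n≤1+n d)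

  -- `escape` prevents the trail from getting stuck on a return to the source: either the source has
  -- spare degree, or it has an edge to a target, and flipping that edge ends the search.
  module Trail {u : Fin n} {b₀ : Fin 2} (c₀ : EdgeColouring G 2) (excess₀ : Excess c₀ u b₀)
               (Target : Fin n → Set) (target? : ∀ x → Dec (Target x))
               (source : ¬ Target u)
               (escape : degree G u < 2 * d ⊎ ∃ λ x → Target x × Adj G u x ≡ true) where

    open Excess excess₀ using () renaming (at≤ to at≤₀; elsewhere to elsewhere₀)

    -- Indicator of the source, whose first departure is not preceded by an arrival.
    δ : Fin n → ℕ
    δ v = 𝟙 ⌊ v ≟ u ⌋

    agree? : ∀ (c : EdgeColouring G 2) x y → Dec (colour c x y ≡ colour c₀ x y)
    agree? c x y = ≡-dec _≟_ (colour c x y) (colour c₀ x y)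

    -- Every flip destroys agreement with `c₀`, so this count decreases along the trail and makes
    -- the search terminate.
    agreement : EdgeColouring G 2 → ℕ
    agreement c = sum (λ x → count (λ y → ⌊ agree? c x y ⌋))

    -- Requiring the original colour as well lets the trail use each edge at most once.
    Flippable : EdgeColouring G 2 → Fin n → Fin 2 → Fin n → Set
    Flippable c w b y = colour c w y ≡ just b × colour c₀ w y ≡ just b

    flippable? : ∀ c w b y → Dec (Flippable c w b y)
    flippable? c w b y = (≡-dec _≟_ (colour c w y) (just b)) ×-dec (≡-dec _≟_ (colour c₀ w y) (just b))

    module Overlap {c : EdgeColouring G 2} {w : Fin n} {b : Fin 2} (excess : Excess c w b)
        (stuck : ∀ y → ¬ Flippable c w b y) where
      either : Fin n → Bool
      either y = hasColour (colour c w y) b ∨ hasColour (colour c₀ w y) b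

      either⇒adjacent : ∀ y → either y ≡ true → Adj G w y ≡ true
      either⇒adjacent y e with hasColour (colour c w y) b in cb
      ... | true  = coloured⇒adjacent c (hasColour-sound cb)
      ... | false = coloured⇒adjacent c₀ (hasColour-sound e)

      disjoint : suc d + classSize c₀ w b ≤ count either
      disjoint = subst (λ s → s + classSize c₀ w b ≤ count either) (Excess.at excess)
          (count-disjoint exclusive)
        where
        exclusive : ∀ y → 𝟙 (hasColour (colour c w y) b) + 𝟙 (hasColour (colour c₀ w y) b) ≤ 𝟙 (either y)
        exclusive y with hasColour (colour c w y) b in cb | hasColour (colour c₀ w y) b in c₀b
        ... | true  | true  = ⊥-elim (stuck y (hasColour-sound cb , hasColour-sound c₀b))
        ... | true  | false = ≤-refl
        ... | false | _     = ≤-refl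

    -- The bounds express that each passage of the trail through a vertex takes one edge from
    -- either class and gives it to the other, and that the trail starts at u.
    record State (c : EdgeColouring G 2) (w : Fin n) (b : Fin 2) : Set where
      field
        excess     : Excess c w b
        searching  : ¬ Target w
        unflipped  : ∀ x → Target x → colour c u x ≡ colour c₀ u x
        classSize≤ : ∀ v b′ → v ≢ w → classSize c v b′ ≤ classSize c₀ v b′ + δ v
        excess≤    : classSize c w b ≤ suc (classSize c₀ w b + δ w)

      d≤ : d ≤ classSize c₀ w b + δ w
      d≤ = s≤s⁻¹ (subst (_≤ _) (Excess.at excess) excess≤)

    classSize₀≤ : ∀ v b → classSize c₀ v b ≤ d + δ v
    classSize₀≤ v b with v ≟ u
    ... | yes refl = subst (classSize c₀ u b ≤_) (+-comm 1 d) (at≤₀ b)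
    ... | no v≢u   = ≤-trans (elsewhere₀ v b v≢u) (m≤m+n d 0)

    module _ {c : EdgeColouring G 2} {w : Fin n} {b : Fin 2} (σ : State c w b) where
      open State σ

      -- If every b-edge at w has been flipped, the b-edges of c and of c₀ at w are disjoint.
      -- Together they number at least 2d + 1, or 2d if w is the source; but the source has
      -- degree below 2d or an edge to a target, which is never flipped.
      not-stuck : (∀ y → ¬ Flippable c w b y) → ⊥
      not-stuck stuck with w ≟ u | d≤
      ... | no _     | le = 1+n≰n (≤-trans (s≤s (+-monoʳ-≤ d (subst (d ≤_) (+-identityʳ _) le)))
                              (≤-trans disjoint (≤-trans (count-mono either⇒adjacent) (degree≤d+d w))))
        where open Overlap excess stuck
      ... | yes refl | le = 1+n≰n (≤-trans (s≤s (≤-trans (+-monoʳ-≤ d (subst (d ≤_) (+-comm _ 1) le))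
                              (≤-trans (≤-reflexive (+-suc d _)) disjoint))) (few escape))
        where
        open Overlap excess stuck
        few : (degree G u < 2 * d ⊎ ∃ λ x → Target x × Adj G u x ≡ true) → count either < d + d
        few (inj₁ small) = ≤-<-trans (count-mono either⇒adjacent) (subst (degree G u <_)
            (cong (d +_) (+-identityʳ d)) small)
        few (inj₂ (x , tx , ux)) = <-≤-trans (count-mono-< either⇒adjacent x neither ux) (degree≤d+d u)
          where
          neither : either x ≡ false
          neither = cong₂ _∨_ (hasColour-other (λ cb → stuck x (cb , trans (≡-sym (unflipped x tx)) cb)))
                              (hasColour-other (λ cb → stuck x (trans (unflipped x tx) cb , cb)))

      flip : ∀ {y} → Flippable c w b y → EdgeColouring G 2
      flip (cwy , _) = recolour c (coloured⇒adjacent c cwy) (other b)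

      -- The flipped edge had colour `b` in both colourings and now differs from `c₀`; all other
      -- edges keep their colour.
      flip-agreement : ∀ {y} (φ : Flippable c w b y) → agreement (flip φ) < agreement c
      flip-agreement {y} φ@(cwy , c₀wy) = sum-mono-< (λ x → count-mono (shrink x)) w
        (count-mono-< (shrink w) y
          (⌊⌋-false (agree? (flip φ) w y) (λ eq →
              other-≢ b (just-injective (trans (≡-sym (override-on (colour c) (inj₁ (refl , refl))))
              (trans eq c₀wy)))))
          (⌊⌋-true (agree? c w y) (trans cwy (≡-sym c₀wy))))
        where
        shrink : ∀ x z → ⌊ agree? (flip φ) x z ⌋ ≡ true → ⌊ agree? c x z ⌋ ≡ true
        shrink x z eq with sameEdge? w y x z
        ... | yes e = ⌊⌋-true (agree? c x z) (trans (trans (colour-sameEdge c e) cwy)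
            (≡-sym (trans (colour-sameEdge c₀ e) c₀wy)))
        ... | no ¬e = eq

      module _ {y : Fin n} (φ : Flippable c w b y) where
        private
          cwy = proj₁ φ
          c′  = flip φ
          here′ : SameEdge w y w y
          here′ = inj₁ (refl , refl)
          there′ : SameEdge w y y w
          there′ = inj₂ (refl , refl)
          cyw : colour c y w ≡ just b
          cyw = trans (colour-sym c y w) cwy
          o≢ : just (other b) ≢ just b
          o≢ = other-≢ b ∘ just-injective
          ≢o : just b ≢ just (other b)
          ≢o = o≢ ∘ ≡-sym
          w≢y : w ≢ y
          w≢y = adjacent⇒≢ G (coloured⇒adjacent c cwy)

        w-old : classSize c′ w b ≡ d
        w-old = suc-injective (trans (≡-sym (classDegree-lose (colour c) here′ cwy o≢)) (Excess.at excess))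

        w-new : classSize c′ w (other b) ≡ suc (classSize c w (other b))
        w-new = classDegree-gain (colour c) here′ (λ e → ≢o (trans (≡-sym cwy) e))

        y-old : classSize c y b ≡ suc (classSize c′ y b)
        y-old = classDegree-lose (colour c) there′ cyw o≢

        y-new : classSize c′ y (other b) ≡ suc (classSize c y (other b))
        y-new = classDegree-gain (colour c) there′ (λ e → ≢o (trans (≡-sym cyw) e))

        unchanged : ∀ v b′ → v ≢ w → v ≢ y → classSize c′ v b′ ≡ classSize c v b′
        unchanged v b′ v≢w v≢y = classDegree-keep (colour c) λ
          { _ (inj₁ (v≡w , _)) → contradiction v≡w v≢w
          ; _ (inj₂ (v≡y , _)) → contradiction v≡y v≢y }

        -- The excess at `w` is gone: class `b` drops to `d`, and the other class had room by
        -- `deficient`.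
        flip≤ : ∀ v b′ → v ≢ y → classSize c′ v b′ ≤ d
        flip≤ v b′ v≢y with toSum (v ≟ w)
        ... | inj₂ v≢w = ≤-trans (≤-reflexive (unchanged v b′ v≢w v≢y)) (Excess.elsewhere excess v b′ v≢w)
        ... | inj₁ refl with same-or-other b b′
        ...   | inj₁ refl = ≤-reflexive w-old
        ...   | inj₂ refl = ≤-trans (≤-reflexive w-new) (Excess.deficient excess)

        balanced : classSize c′ y (other b) ≤ d → HasDefect c′ d
        balanced le v b′ with toSum (v ≟ y)
        ... | inj₂ v≢y = flip≤ v b′ v≢y
        ... | inj₁ refl with same-or-other b b′
        ...   | inj₁ refl = ≤-trans (n≤1+n _) (≤-trans (≤-reflexive (≡-sym y-old))
            (Excess.elsewhere excess y b (w≢y ∘ ≡-sym)))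
        ...   | inj₂ refl = le

        -- `y` had at most `d` edges of the other class and gained one, so exceeding the bound means
        -- exactly `d + 1`.
        moved : ¬ (classSize c′ y (other b) ≤ d) → Excess c′ y (other b)
        moved ¬le .Excess.at = ≤-antisym
          (≤-trans (≤-reflexive y-new) (s≤s (Excess.elsewhere excess y (other b) (w≢y ∘ ≡-sym)))) (≰⇒> ¬le)
        moved ¬le .Excess.elsewhere v b′ = flip≤ v b′

        moved-state : ¬ Target y → ¬ (classSize c′ y (other b) ≤ d) → State c′ y (other b)
        moved-state ¬ty ¬le .State.excess = moved ¬le
        moved-state ¬ty ¬le .State.searching = ¬ty
        -- Neither end of the flipped edge is a target, so no edge from `u` to a target changes.
        moved-state ¬ty ¬le .State.unflipped x tx = trans (override-off (colour c) λ
          { (inj₁ (_ , refl)) → ¬ty tx ; (inj₂ (_ , refl)) → searching tx }) (unflipped x tx)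
        moved-state ¬ty ¬le .State.excess≤ = ≤-trans (≤-reflexive y-new)
            (s≤s (classSize≤ y (other b) (w≢y ∘ ≡-sym)))
        moved-state ¬ty ¬le .State.classSize≤ v b′ v≢y with toSum (v ≟ w)
        ... | inj₂ v≢w = ≤-trans (≤-reflexive (unchanged v b′ v≢w v≢y)) (classSize≤ v b′ v≢w)
        ... | inj₁ refl with same-or-other b b′
        ...   | inj₁ refl = ≤-trans (≤-reflexive w-old) d≤
        -- The class sizes at `w` add up to its degree under `c` and under `c₀`. The `d + 1` edges
        -- of class `b` under `c` therefore leave room for one more edge in the other class.
        ...   | inj₂ refl = ≤-trans (≤-reflexive w-new) (+-cancelˡ-≤ d _ _ (begin
          d + suc (classSize c w (other b))                        ≡⟨ +-suc d _ ⟩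
          suc d + classSize c w (other b)
            ≡⟨ cong (_+ classSize c w (other b)) (Excess.at excess) ⟨
          classSize c w b + classSize c w (other b)
            ≡⟨ trans (classSizes c w b) (≡-sym (classSizes c₀ w b)) ⟩
          classSize c₀ w b + classSize c₀ w (other b)              ≤⟨ +-monoˡ-≤ _ (classSize₀≤ w b) ⟩
          d + δ w + classSize c₀ w (other b)                       ≡⟨ +-assoc d (δ w) _ ⟩
          d + (δ w + classSize c₀ w (other b))                     ≡⟨ cong (d +_) (+-comm (δ w) _) ⟩
          d + (classSize c₀ w (other b) + δ w)                     ∎))
          where open ≤-Reasoning

    Outcome : Set
    Outcome = Colourable G 2 d ⊎ ∃ λ x → Target x × ∃ λ c → ∃ λ b → Excess c x b

    search : ∀ c w b → Acc _<_ (agreement c) → State c w b → Outcome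
    search c w b (acc rec) σ with any? (flippable? c w b)
    ... | no stuck = ⊥-elim (not-stuck σ (λ y φ → stuck (y , φ)))
    ... | yes (y , φ) with classSize (flip σ φ) y (other b) ≤? d | target? y
    ...   | yes le | _      = inj₁ (flip σ φ , balanced σ φ le)
    ...   | no ¬le | yes ty = inj₂ (y , ty , flip σ φ , other b , moved σ φ ¬le)
    ...   | no ¬le | no ¬ty = search _ y (other b) (rec (flip-agreement σ φ)) (moved-state σ φ ¬ty ¬le)

    outcome : Outcome
    outcome = search c₀ u b₀ (<-wellFounded _) record
      { excess     = excess₀
      ; searching  = source
      ; unflipped  = λ _ _ → refl
      ; classSize≤ = λ v b′ _ → m≤m+n _ _
      ; excess≤    = ≤-trans (m≤m+n _ _) (n≤1+n _)
      }

  -- Each edge of the path is handled by a fresh trail from the current colouring, with the next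
  -- vertex as its only target; that edge itself provides the `escape`.
  escape-to : ∀ {u r c b} → Reachable G u r → Excess c u b → Colourable G 2 d ⊎ ∃ λ c → ∃ λ b → Excess c r b
  escape-to here ex = inj₂ (_ , _ , ex)
  escape-to {u} (step {v = x} ux p) ex
    with Trail.outcome _ ex (_≡ x) (_≟ x) (adjacent⇒≢ G ux) (inj₂ (x , refl , ux))
  ... | inj₁ bal                       = inj₁ bal
  ... | inj₂ (_ , refl , _ , _ , ex′)  = escape-to p ex′

  -- Without targets the trail can only end by absorbing the excess.
  resolve-at-low-degree : ∀ {r c b} → degree G r < 2 * d → Excess c r b → Colourable G 2 d
  resolve-at-low-degree low ex with Trail.outcome _ ex (λ _ → ⊥) (λ _ → no λ ()) (λ ()) (inj₁ low)
  ... | inj₁ bal = bal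

  Regular : (Fin n → Bool) → Set
  Regular S = ∀ w → S w ≡ true → degree G w ≡ 2 * d

  Closed : (Fin n → Bool) → Set
  Closed S = ∀ {x y} → S x ≡ true → Adj G x y ≡ true → S y ≡ true

  -- As `S` is closed, the edges of class `b` that start in `S` also end there and form a symmetric
  -- relation.
  class-handshake : ∀ c b S → Closed S → Even (sum (λ x → 𝟙 (S x) * classSize c x b))
  class-handshake c b S closed = subst Even (sum-cong-≗ restricted) (handshake R R-sym R-irrefl)
    where
    R : Fin n → Fin n → Bool
    R x y = S x ∧ hasColour (colour c x y) b
    R-sym⇒ : ∀ x y → R x y ≡ true → R y x ≡ true
    R-sym⇒ x y e with S x in Sx | hasColour (colour c x y) b in cxy
    ... | true | true rewrite closed Sx (coloured⇒adjacent c (hasColour-sound cxy))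
                 | colour-sym c y x = cxy
    R-sym : ∀ x y → R x y ≡ R y x
    R-sym x y = true-iff⇒≡ (R-sym⇒ x y) (R-sym⇒ y x)
    R-irrefl : ∀ x → R x x ≡ false
    R-irrefl x rewrite nonadjacent⇒uncoloured c (Graph.irrfl G x) = ∧-zeroʳ (S x)
    restricted : ∀ x → count (R x) ≡ 𝟙 (S x) * classSize c x b
    restricted x with S x
    ... | true  = ≡-sym (+-identityʳ _)
    ... | false = count-none {n} (λ _ → refl)

  -- At the excess vertex class b has d + 1 edges and at every other vertex of S exactly d,
  -- so by the handshake lemma d|S| + 1 is even.
  regular-excess-odd : ∀ {u c b} S → Closed S → Regular S → S u ≡ true → Excess c u b → ¬ Even (d * count S)
  regular-excess-odd {u} {c} {b} S closed regular Su ex even =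
    contradiction (∣m+n∣m⇒∣n (subst Even total (class-handshake c b S closed)) even) (>⇒∤ (s≤s (s≤s z≤n)))
    where
    exact : ∀ x → S x ≡ true → x ≢ u → classSize c x b ≡ d
    exact x Sx x≢u = saturated c (regular x Sx) (Excess.elsewhere ex x b x≢u) (Excess.elsewhere ex x
        (other b) x≢u)
    total : sum (λ x → 𝟙 (S x) * classSize c x b) ≡ d * count S + 1
    -- Replacing the class size at `u` by `d` changes a single summand; the auxiliary term is then
    -- cancelled.
    total = +-cancelʳ-≡ (𝟙 (S u) * d) _ _ (trans (sum-update u agree) (begin
      sum (λ x → 𝟙 (S x) * d) + 𝟙 (S u) * classSize c u b
        ≡⟨ cong₂ _+_ (≡-sym (*-distribʳ-sum d (𝟙 ∘ S))) (cong₂ _*_ (cong 𝟙 Su) (Excess.at ex)) ⟩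
      sum (𝟙 ∘ S) * d + 1 * suc d                          ≡⟨ cong (λ s → s * d + 1 * suc d) (count≡sum S) ⟨
      count S * d + 1 * suc d
        ≡⟨ solve 2 (λ s d → s :* d :+ con 1 :* (con 1 :+ d) := d :* s :+ con 1 :+ con 1 :* d) refl
            (count S) d ⟩
      d * count S + 1 + 1 * d                              ≡⟨ cong (λ b → d * count S + 1 + 𝟙 b * d) Su ⟨
      d * count S + 1 + 𝟙 (S u) * d                        ∎))
      where
      open ≡-Reasoning
      open +-*-Solver
      agree : ∀ x → x ≢ u → 𝟙 (S x) * classSize c x b ≡ 𝟙 (S x) * d
      agree x x≢u with S x in Sx
      ... | true  = cong (1 *_) (exact x Sx x≢u)
      ... | false = refl

  -- The hypothesis concerns sets that form the component of one of their vertices. A vertex of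
  -- degree below `2 * d` in the component of `u` takes the excess; without one, the parity argument
  -- applies.
  resolve : (∀ S → Closed S → Regular S → (∃ λ v →
      (∀ w → S w ≡ true → Reachable G v w) × S v ≡ true) → Even (d * count S)) →
            ∀ {u c b} → Excess c u b → Colourable G 2 d
  resolve even {u} ex with component G u
  ... | S , sound , complete with any? (λ r → (S r Bool.≟ true) ×-dec (degree G r <? 2 * d))
  ...   | yes (r , Sr , low) = Sum.[ (λ bal → bal) , (λ { (_ , _ , ex′) →
      resolve-at-low-degree low ex′ }) ]′ (escape-to (sound r Sr) ex)
  ...   | no none = ⊥-elim (regular-excess-odd S closed regular (complete u here) ex
      (even S closed regular (u , sound , complete u here)))
    where
    closed : Closed S
    closed {x} {y} Sx xy = complete y (reachable-trans G (sound x Sx) (step xy here))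
    regular : Regular S
    regular w Sw = ≤-antisym (degree≤ w) (≮⇒≥ (λ low → none (w , Sw , low)))

-- Pigeonhole: with at least `d` edges of every colour at `v`, its degree would be at least `k * d`.
free-colour : ∀ {n k d} {G : Graph n} (c : EdgeColouring G k) v → degree G v < k * d →
              ∃ λ i → classDegree (colour c) v i < d
free-colour {k = k} {d} {G} c v small with any? (λ i → classDegree (colour c) v i <? d)
... | yes free = free
... | no none  = contradiction (≤-trans (≤-reflexive (≡-sym (sum-const k d)))
    (≤-trans (sum-mono (λ i → ≮⇒≥ (λ lt → none (i , lt))))
                   (≤-reflexive (sum-classDegree≡degree c v)))) (<⇒≱ small)

module _ {n k : ℕ} {G : Graph n} {u v : Fin n} (uv : Adj G u v ≡ true)
    (c : EdgeColouring (delete G u v) k) (a : Fin k) where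

  colourDeleted-gain : ∀ {x y} → SameEdge u v x y →
    classDegree (colour (colourDeleted uv c a)) x a ≡ suc (classDegree (colour c) x a)
  colourDeleted-gain e = classDegree-gain (colour c) e λ eq →
      contradiction (trans (≡-sym (deleted-uncoloured {G = G} c e)) eq) (λ ())

  colourDeleted-colour : ∀ x {i} → i ≢ a →
    classDegree (colour (colourDeleted uv c a)) x i ≡ classDegree (colour c) x i
  colourDeleted-colour x {i} i≢a = classDegree-keep (colour c) λ y e →
    trans (hasColour-other (λ eq → i≢a (≡-sym (just-injective eq))))
        (≡-sym (cong (λ m → hasColour m i) (deleted-uncoloured {G = G} c e)))

  colourDeleted-vertex : ∀ {x} i → x ≢ u → x ≢ v →
    classDegree (colour (colourDeleted uv c a)) x i ≡ classDegree (colour c) x i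
  colourDeleted-vertex i x≢u x≢v = classDegree-keep (colour c) λ
    { _ (inj₁ (x≡u , _)) → contradiction x≡u x≢u
    ; _ (inj₂ (x≡v , _)) → contradiction x≡v x≢v }

  -- Only class `a` at the two ends of `uv` grows. The statement is made vertex by vertex so that it
  -- still applies at the other vertices when `v` has no room.
  colourDeleted-≤ : ∀ {d} x i → classDegree (colour c) x i ≤ d →
    (i ≡ a → x ≡ u ⊎ x ≡ v → classDegree (colour c) x a < d) →
    classDegree (colour (colourDeleted uv c a)) x i ≤ d
  colourDeleted-≤ x i le lt with toSum (i ≟ a) | toSum (x ≟ u) | toSum (x ≟ v)
  ... | inj₂ i≢a  | _         | _         = ≤-trans (≤-reflexive (colourDeleted-colour x i≢a)) le
  ... | inj₁ refl | inj₁ refl | _         =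
      ≤-trans (≤-reflexive (colourDeleted-gain (inj₁ (refl , refl)))) (lt refl (inj₁ refl))
  ... | inj₁ refl | inj₂ _    | inj₁ refl =
      ≤-trans (≤-reflexive (colourDeleted-gain (inj₂ (refl , refl)))) (lt refl (inj₂ refl))
  ... | inj₁ refl | inj₂ x≢u  | inj₂ x≢v  = ≤-trans (≤-reflexive (colourDeleted-vertex i x≢u x≢v)) le

-- d|S| is the number of edges of a 2d-regular component S.
ComponentsEven : ∀ {n} → Graph n → ℕ → Set
ComponentsEven {n} G d = ∀ v (S : Fin n → Bool) → (∀ w → S w ≡ true → Reachable G v w) →
    (∀ w → Reachable G v w → S w ≡ true) →
  (∀ w → S w ≡ true → degree G w ≡ 2 * d) → Even (d * count S)

reachable-⊆ : ∀ {n} {H G : Graph n} → H ⊆ᴳ G → ∀ {x y} → Reachable H x y → Reachable G x y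
reachable-⊆ H⊆G here       = here
reachable-⊆ H⊆G (step e p) = step (H⊆G _ _ e) (reachable-⊆ H⊆G p)

-- An edge of `G` at `x` missing from `H` would make the degree of `x` in `G` larger.
⊆-adjacent : ∀ {n} {H G : Graph n} → H ⊆ᴳ G → ∀ {x} → degree G x ≤ degree H x → ∀ {y} →
    Adj G x y ≡ true → Adj H x y ≡ true
⊆-adjacent H⊆G {x} le {y} xy = ¬-not (λ ¬xy → contradiction le (<⇒≱ (count-mono-< (H⊆G x) y ¬xy xy)))

two-colouring : ∀ {n} (G : Graph n) d → (∀ v → degree G v ≤ 2 * d) → ComponentsEven G d →
                Colourable G 2 d
two-colouring {n} G d degree≤ even = edge-induction P base insert G (λ _ _ e → e)
  where
  P : Graph n → Set
  P H = H ⊆ᴳ G → Colourable H 2 d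
  base : ∀ H → Edgeless H → P H
  base H edgeless _ = emptyColouring edgeless , emptyColouring-defect {G = H} edgeless d
  insert : ∀ H u v → Adj H u v ≡ true → P (delete H u v) → P H
  insert H u v uv ih H⊆G with ih (λ x y e → H⊆G x y (delete-⊆ H x y e))
  ... | c , defect with free-colour {d = d} c u (≤-trans
      (≤-reflexive (≡-sym (degree-delete H uv (inj₁ (refl , refl)))))
      (≤-trans (degree-⊆ {H = H} {G} H⊆G u) (degree≤ u)))
  ... | a , free with classDegree (colour c) v a <? d
  ...   | yes free′ = colourDeleted uv c a , λ x i → colourDeleted-≤ uv c a x i (defect x i)
                        λ { _ (inj₁ refl) → free ; _ (inj₂ refl) → free′ }
  -- Colouring `uv` with `a` all the same creates an excess at `v` alone.
  ...   | no full = resolve even′ excess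
    where
    degree≤ᴴ : ∀ x → degree H x ≤ 2 * d
    degree≤ᴴ x = ≤-trans (degree-⊆ {H = H} {G} H⊆G x) (degree≤ x)
    open TwoColours H d degree≤ᴴ
    excess : Excess (colourDeleted uv c a) v a
    excess .Excess.at = trans (colourDeleted-gain uv c a (inj₂ (refl , refl)))
        (cong suc (≤-antisym (defect v a) (≮⇒≥ full)))
    excess .Excess.elsewhere x i x≢v = colourDeleted-≤ uv c a x i (defect x i)
      λ { _ (inj₁ refl) → free ; _ (inj₂ x≡v) → contradiction x≡v x≢v }
    even′ : ∀ S → Closed S → Regular S → (∃ λ v → (∀ w → S w ≡ true →
        Reachable H v w) × S v ≡ true) → Even (d * count S)
    -- A vertex of degree `2 * d` in `H` has all its `G`-edges in `H`, so a `2 * d`-regular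
    -- component of `H` is also one of `G`.
    even′ S closed regular (x , sound , Sx) = even x S (λ w Sw → reachable-⊆ H⊆G (sound w Sw))
      (λ w p → closed-reachable G closedᴳ Sx p) λ w Sw →
          ≤-antisym (degree≤ w) (≤-trans (≤-reflexive (≡-sym (regular w Sw))) (degree-⊆ {H = H} {G} H⊆G w))
      where
      closedᴳ : ∀ {y z} → S y ≡ true → Adj G y z ≡ true → S z ≡ true
      closedᴳ {y} Sy yz = closed Sy (⊆-adjacent {H = H} {G} H⊆G
          (≤-trans (degree≤ y) (≤-reflexive (≡-sym (regular y Sy)))) yz)

-- Even defect

module _ {n k : ℕ} {H : Graph n} (c : EdgeColouring H k) (a b : Fin k) where

  -- Serves for redistributing two classes and, when the colouring is proper, as the graph of Kempe
  -- chains.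
  bichromatic : Graph n
  bichromatic .Adj x y = hasColour (colour c x y) a ∨ hasColour (colour c x y) b
  bichromatic .sym x y rewrite colour-sym c x y = refl
  bichromatic .irrfl x rewrite nonadjacent⇒uncoloured c (Graph.irrfl H x) = refl

  bichromatic-sound : ∀ {x y} → Adj bichromatic x y ≡ true → colour c x y ≡ just a ⊎ colour c x y ≡ just b
  bichromatic-sound {x} {y} e with hasColour (colour c x y) a in ca
  ... | true  = inj₁ (hasColour-sound ca)
  ... | false = inj₂ (hasColour-sound e)

  bichromatic-complete : ∀ {x y} → colour c x y ≡ just a ⊎ colour c x y ≡ just b → Adj bichromatic x y ≡ true
  bichromatic-complete (inj₁ ca) = cong (_∨ _) (hasColour-complete ca)
  bichromatic-complete (inj₂ cb) = trans (cong (_ ∨_) (hasColour-complete cb)) (∨-zeroʳ _)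

  degree-bichromatic : ∀ x → degree bichromatic x ≤ classDegree (colour c) x a + classDegree (colour c) x b
  degree-bichromatic x = count-cover (λ y → 𝟙-∨ (hasColour (colour c x y) a))
    where
    𝟙-∨ : ∀ s {t} → 𝟙 (s ∨ t) ≤ 𝟙 s + 𝟙 t
    𝟙-∨ true  = s≤s z≤n
    𝟙-∨ false = ≤-refl

  module Recombine (a≢b : a ≢ b) (g : EdgeColouring bichromatic 2) where

    side : Fin 2 → Fin k
    side zero       = a
    side (suc zero) = b

    pick : Maybe (Fin 2) → Maybe (Fin k) → Maybe (Fin k)
    pick nothing  m = m
    pick (just i) m = just (side i)

    recombined : EdgeColouring H k
    recombined .colour x y = pick (colour g x y) (colour c x y)
    recombined .colour-sym x y = cong₂ pick (colour-sym g x y) (colour-sym c x y)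
    recombined .support x y with colour g x y in gxy
    ... | nothing = support c x y
    ... | just i  = ≡-sym (Sum.[ coloured⇒adjacent c , coloured⇒adjacent c ]′
        (bichromatic-sound (coloured⇒adjacent g gxy)))

    uncoloured-by-g : ∀ {x y} → colour g x y ≡ nothing → ¬ (colour c x y ≡ just a ⊎ colour c x y ≡ just b)
    uncoloured-by-g {x} {y} gxy cxy =
      true≢false (trans (≡-sym (bichromatic-complete cxy)) (trans (≡-sym (support g x y)) (cong is-just gxy)))

    recombined-defect : ∀ {d} → HasDefect g d → (∀ x i → i ≢ a → i ≢ b →
        classDegree (colour c) x i ≤ d) → HasDefect recombined d
    recombined-defect {d} defect old x i with toSum (i ≟ a) | toSum (i ≟ b)
    ... | inj₁ refl | _ = ≤-trans (count-mono has) (defect x zero)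
      where
      has : ∀ y → hasColour (pick (colour g x y) (colour c x y)) a ≡ true →
          hasColour (colour g x y) zero ≡ true
      has y e with colour g x y in gxy
      ... | nothing         = contradiction (inj₁ (hasColour-sound e)) (uncoloured-by-g gxy)
      ... | just zero       = refl
      ... | just (suc zero) = contradiction (≡-sym (just-injective (hasColour-sound {m = just b} e))) a≢b
    ... | inj₂ _ | inj₁ refl = ≤-trans (count-mono has) (defect x (suc zero))
      where
      has : ∀ y → hasColour (pick (colour g x y) (colour c x y)) b ≡ true →
          hasColour (colour g x y) (suc zero) ≡ true
      has y e with colour g x y in gxy
      ... | nothing         = contradiction (inj₂ (hasColour-sound e)) (uncoloured-by-g gxy)
      ... | just zero       = contradiction (just-injective (hasColour-sound {m = just a} e)) a≢b
      ... | just (suc zero) = refl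
    ... | inj₂ i≢a | inj₂ i≢b = ≤-trans (count-mono has) (old x i i≢a i≢b)
      where
      has : ∀ y → hasColour (pick (colour g x y) (colour c x y)) i ≡ true → hasColour (colour c x y) i ≡ true
      has y e with colour g x y
      ... | nothing         = e
      ... | just zero       = contradiction (≡-sym (just-injective (hasColour-sound {m = just a} e))) i≢a
      ... | just (suc zero) = contradiction (≡-sym (just-injective (hasColour-sound {m = just b} e))) i≢b

even-defect-colouring : ∀ {n} (G : Graph n) d k → Even d → (∀ v → degree G v ≤ k * d) →
                        Colourable G k d
even-defect-colouring {n} G d k even degree≤ = edge-induction P base insert G (λ _ _ e → e)
  where
  P : Graph n → Set
  P H = H ⊆ᴳ G → Colourable H k d
  base : ∀ H → Edgeless H → P H
  base H edgeless _ = emptyColouring edgeless , emptyColouring-defect {G = H} edgeless d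
  insert : ∀ H u v → Adj H u v ≡ true → P (delete H u v) → P H
  insert H u v uv ih H⊆G with ih (λ x y e → H⊆G x y (delete-⊆ H x y e))
  ... | c , defect = from-free (free-colour c u (small (inj₁ (refl , refl))))
      (free-colour c v (small (inj₂ (refl , refl))))
    where
    small : ∀ {x y} → SameEdge u v x y → degree (delete H u v) x < k * d
    small {x} e = ≤-trans (≤-reflexive (≡-sym (degree-delete H uv e)))
        (≤-trans (degree-⊆ {H = H} {G} H⊆G x) (degree≤ x))
    from-free : (∃ λ a → classDegree (colour c) u a < d) → (∃ λ b → classDegree (colour c) v b < d) →
                Colourable H k d
    from-free (a , free-u) (b , free-v) with classDegree (colour c) v a <? d
    ... | yes free-v′ = colourDeleted uv c a , λ x i → colourDeleted-≤ uv c a x i (defect x i)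
                          λ { _ (inj₁ refl) → free-u ; _ (inj₂ refl) → free-v′ }
    -- After colouring `uv` with `a`, the classes `a` and `b` have at most `d + 1` and `d - 1` edges
    -- at `v`, so their union has maximum degree at most `2 * d` and can be split afresh.
    ... | no full = recombined , recombined-defect g-defect (λ x i i≢a _ →
        ≤-trans (≤-reflexive (colourDeleted-colour uv c a x i≢a)) (defect x i))
      where
      a≢b : a ≢ b
      a≢b refl = full free-v
      c′ : EdgeColouring H k
      c′ = colourDeleted uv c a
      b-class≤ : ∀ x → classDegree (colour c′) x b ≤ classDegree (colour c) x b
      b-class≤ x = ≤-reflexive (colourDeleted-colour uv c a x (a≢b ∘ ≡-sym))
      degree≤′ : ∀ x → degree (bichromatic c′ a b) x ≤ 2 * d
      degree≤′ x = ≤-trans (degree-bichromatic c′ a b x) (≤-trans (sizes (toSum (x ≟ v)))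
          (≤-reflexive (cong (d +_) (≡-sym (+-identityʳ d)))))
        where
        sizes : x ≡ v ⊎ x ≢ v → classDegree (colour c′) x a + classDegree (colour c′) x b ≤ d + d
        sizes (inj₁ refl) =
            ≤-trans (+-mono-≤ (≤-trans (≤-reflexive (colourDeleted-gain uv c a
            (inj₂ (refl , refl)))) (s≤s (defect v a))) (b-class≤ v))
                              (≤-trans (≤-reflexive (≡-sym (+-suc d _))) (+-monoʳ-≤ d free-v))
        sizes (inj₂ x≢v) = +-mono-≤ (colourDeleted-≤ uv c a x a (defect x a) λ { _ (inj₁ refl) →
            free-u ; _ (inj₂ x≡v) → contradiction x≡v x≢v })
                                    (≤-trans (b-class≤ x) (defect x b))
      split : Colourable (bichromatic c′ a b) 2 d
      -- As `d` is even, so is `d` times the order of any component.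
      split = two-colouring (bichromatic c′ a b) d degree≤′ (λ _ S _ _ _ → ∣m⇒∣m*n (count S) even)
      g : EdgeColouring (bichromatic c′ a b) 2
      g = proj₁ split
      g-defect : HasDefect g d
      g-defect = proj₂ split
      open Recombine c′ a b a≢b g

-- Vizing's theorem

transpose-injective : ∀ {k} (a b : Fin k) {i j} → transpose a b i ≡ transpose a b j → i ≡ j
transpose-injective a b {i} {j} eq =
  trans (≡-sym (transpose-inverse b a)) (trans (cong (transpose b a) eq) (transpose-inverse b a))

transpose-left : ∀ {k} (a b : Fin k) → transpose a b a ≡ b
transpose-left a b rewrite dec-true (a ≟ a) refl = refl

transpose-preimage : ∀ {k} (a b : Fin k) {i} → transpose a b i ≡ b → i ≡ a
transpose-preimage a b eq = transpose-injective a b (trans eq (≡-sym (transpose-left a b)))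

transpose-fixed : ∀ {k} {a b i : Fin k} → i ≢ a → i ≢ b → transpose a b i ≡ i
transpose-fixed {a = a} {b} {i} i≢a i≢b rewrite dec-false (i ≟ a) i≢a | dec-false (i ≟ b) i≢b = refl

-- The component of u in a graph of maximum degree 2 is a path starting at the leaf u. We follow
-- it, T being the set of visited vertices and w the last of them, until it ends at v or z.
leaf-partner-unique : ∀ {n} (X : Graph n) →
  (∀ {x p q r} → Adj X x p ≡ true → Adj X x q ≡ true → Adj X x r ≡ true → p ≡ q ⊎ p ≡ r ⊎ q ≡ r) →
  let Leaf = λ x → ∀ {p q} → Adj X x p ≡ true → Adj X x q ≡ true → p ≡ q in
  ∀ {u v z} → Leaf u → Leaf v → Leaf z → v ≢ u → z ≢ u → Reachable X u v → Reachable X u z → v ≡ z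
leaf-partner-unique {n} X thin {u} {v} {z} leaf-u leaf-v leaf-z v≢u z≢u u⇝v u⇝z =
  walk (λ t → ⌊ u ≟ t ⌋) u (<-wellFounded _) record
    { source  = ⌊⌋-true (u ≟ u) refl
    ; last    = ⌊⌋-true (u ≟ u) refl
    ; no-v    = ⌊⌋-false (u ≟ v) (v≢u ∘ ≡-sym)
    ; no-z    = ⌊⌋-false (u ≟ z) (z≢u ∘ ≡-sym)
    ; inner   = λ {t} t∈T t≢w _ → contradiction (≡-sym (⌊⌋-sound (u ≟ t) t∈T)) t≢w
    ; forward = λ wp wq _ _ → leaf-u wp wq
    }
  where
  record Walk (T : Fin n → Bool) (w : Fin n) : Set where
    field
      source  : T u ≡ true
      last    : T w ≡ true
      no-v    : T v ≡ false
      no-z    : T z ≡ false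
      inner   : ∀ {t s} → T t ≡ true → t ≢ w → Adj X t s ≡ true → T s ≡ true
      forward : ∀ {p q} → Adj X w p ≡ true → Adj X w q ≡ true → T p ≡ false → T q ≡ false → p ≡ q

  walk : ∀ T w → Acc _<_ (count (not ∘ T)) → Walk T w → v ≡ z
  walk T w (acc rec) ω with any? (λ y → (Adj X w y Bool.≟ true) ×-dec (T y Bool.≟ false))
  -- If the path stopped here, `T` would be closed and would contain `v`.
  ... | no ended = contradiction (closed-reachable X {P = λ t → T t ≡ true} closed source u⇝v)
      (λ Tv → true≢false (trans (≡-sym Tv) no-v))
    where
    open Walk ω
    closed : ∀ {t s} → T t ≡ true → Adj X t s ≡ true → T s ≡ true
    closed {t} {s} Tt ts with t ≟ w
    ... | no t≢w   = inner Tt t≢w ts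
    ... | yes refl = ¬-not (λ ¬Ts → ended (s , ts , ¬Ts))
  ... | yes (y , wy , ¬Ty) = arrive (toSum (y ≟ v)) (toSum (y ≟ z))
    where
    open Walk ω
    T′ : Fin n → Bool
    T′ = add y T
    T′⇒T : ∀ {t} → T′ t ≡ true → t ≢ y → T t ≡ true
    T′⇒T T′t t≢y with add-inv y T T′t
    ... | inj₁ y≡t = contradiction (≡-sym y≡t) t≢y
    ... | inj₂ Tt  = Tt
    T′-false : ∀ {t} → y ≢ t → T t ≡ false → T′ t ≡ false
    T′-false y≢t ¬Tt = ¬-not (λ T′t → true≢false (trans (≡-sym (T′⇒T T′t (y≢t ∘ ≡-sym))) ¬Tt))
    inner′ : ∀ {t s} → T′ t ≡ true → t ≢ y → Adj X t s ≡ true → T′ s ≡ true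
    inner′ {t} {s} T′t t≢y ts with toSum (t ≟ w)
    ... | inj₂ t≢w = add-old y T (inner (T′⇒T T′t t≢y) t≢w ts)
    ... | inj₁ refl with toSum (T s Bool.≟ true)
    ...   | inj₁ Ts  = add-old y T Ts
    ...   | inj₂ ¬Ts = subst (λ s → T′ s ≡ true) (forward wy ts ¬Ty (¬-not ¬Ts)) (add-new y T)
    -- If `y` is a leaf, the path ends there: `T′` is closed, so a vertex reachable from `u` but
    -- outside `T` must be `y`.
    ends : (∀ {p q} → Adj X y p ≡ true → Adj X y q ≡ true → p ≡ q) → ∀ {t} → Reachable X u t → T′ t ≡ true
    ends leaf-y = closed-reachable X {P = λ t → T′ t ≡ true} closed (add-old y T source)
      where
      closed : ∀ {t s} → T′ t ≡ true → Adj X t s ≡ true → T′ s ≡ true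
      closed {t} {s} T′t ts with toSum (t ≟ y)
      ... | inj₂ t≢y  = inner′ T′t t≢y ts
      ... | inj₁ refl = subst (λ s → T′ s ≡ true) (leaf-y (adjacent-sym X wy) ts) (add-old y T last)
    is-y : ∀ {t} → T t ≡ false → T′ t ≡ true → y ≡ t
    is-y ¬Tt T′t with add-inv y T T′t
    ... | inj₁ y≡t = y≡t
    ... | inj₂ Tt  = contradiction (trans (≡-sym Tt) ¬Tt) true≢false
    arrive : y ≡ v ⊎ y ≢ v → y ≡ z ⊎ y ≢ z → v ≡ z
    arrive (inj₁ refl) _           = is-y no-z (ends leaf-v u⇝z)
    arrive (inj₂ _)    (inj₁ refl) = ≡-sym (is-y no-v (ends leaf-z u⇝v))
    arrive (inj₂ y≢v)  (inj₂ y≢z)  = walk T′ y (rec (add-smaller y T ¬Ty)) record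
      { source  = add-old y T source
      ; last    = add-new y T
      ; no-v    = T′-false y≢v no-v
      ; no-z    = T′-false y≢z no-z
      ; inner   = inner′
      ; forward = forward′
      }
      where
      -- `y` has at most two neighbours, one of which is the visited vertex `w`.
      forward′ : ∀ {p q} → Adj X y p ≡ true → Adj X y q ≡ true → T′ p ≡ false → T′ q ≡ false → p ≡ q
      forward′ yp yq ¬T′p ¬T′q with thin yp yq (adjacent-sym X wy)
      ... | inj₁ p≡q         = p≡q
      ... | inj₂ (inj₁ refl) = contradiction (trans (≡-sym (add-old y T last)) ¬T′p) true≢false
      ... | inj₂ (inj₂ refl) = contradiction (trans (≡-sym (add-old y T last)) ¬T′q) true≢false

-- Proper colourings and Kempe changes.

module _ {n k : ℕ} {G : Graph n} where

  Proper : EdgeColouring G k → Set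
  Proper c = ∀ {x y z i} → colour c x y ≡ just i → colour c x z ≡ just i → y ≡ z

  Missing : EdgeColouring G k → Fin n → Fin k → Set
  Missing c x i = ∀ {y} → colour c x y ≢ just i

  classDegree<1⇒missing : ∀ c {x i} → classDegree (colour c) x i < 1 → Missing c x i
  classDegree<1⇒missing c lt {y} e = contradiction (count-pos y (hasColour-complete e)) (<⇒≱ lt)

  proper⇒defect-1 : ∀ {c} → Proper c → HasDefect c 1
  proper⇒defect-1 proper x i = count-unique (λ y z ey ez → proper (hasColour-sound ey) (hasColour-sound ez))

  module _ (c : EdgeColouring G k) (proper : Proper c) (a b : Fin k) where
    private
      X : Graph n
      X = bichromatic c a b

    bichromatic-thin : ∀ {x p q r} → Adj X x p ≡ true → Adj X x q ≡ true → Adj X x r ≡ true →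
        p ≡ q ⊎ p ≡ r ⊎ q ≡ r
    bichromatic-thin xp xq xr
      with bichromatic-sound c a b xp | bichromatic-sound c a b xq | bichromatic-sound c a b xr
    ... | inj₁ p | inj₁ q | _      = inj₁ (proper p q)
    ... | inj₁ p | inj₂ q | inj₁ r = inj₂ (inj₁ (proper p r))
    ... | inj₁ p | inj₂ q | inj₂ r = inj₂ (inj₂ (proper q r))
    ... | inj₂ p | inj₁ q | inj₁ r = inj₂ (inj₂ (proper q r))
    ... | inj₂ p | inj₁ q | inj₂ r = inj₂ (inj₁ (proper p r))
    ... | inj₂ p | inj₂ q | _      = inj₁ (proper p q)

    missing-left⇒leaf : ∀ {x} → Missing c x a → ∀ {p q} → Adj X x p ≡ true → Adj X x q ≡ true → p ≡ q
    missing-left⇒leaf miss xp xq with bichromatic-sound c a b xp | bichromatic-sound c a b xq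
    ... | inj₁ p | _      = contradiction p miss
    ... | inj₂ _ | inj₁ q = contradiction q miss
    ... | inj₂ p | inj₂ q = proper p q

    missing-right⇒leaf : ∀ {x} → Missing c x b → ∀ {p q} → Adj X x p ≡ true → Adj X x q ≡ true → p ≡ q
    missing-right⇒leaf miss xp xq with bichromatic-sound c a b xp | bichromatic-sound c a b xq
    ... | inj₂ p | _      = contradiction p miss
    ... | inj₁ _ | inj₂ q = contradiction q miss
    ... | inj₁ p | inj₁ q = proper p q

    module KempeChange (S : Fin n → Bool) (closed : ∀ {x y} → S x ≡ true → Adj X x y ≡ true →
        S y ≡ true) where

      -- The choice is made by the first end of an edge alone, so that every vertex sees one
      -- injective renaming and properness is immediate. Symmetry holds because no edge of colour
      -- `a` or `b` leaves `S`.
      exchange : Bool → Maybe (Fin k) → Maybe (Fin k)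
      exchange true  = Maybe.map (transpose a b)
      exchange false = λ m → m

      exchange-fixed : ∀ s {m} → m ≢ just a → m ≢ just b → exchange s m ≡ m
      exchange-fixed true  {nothing} _   _   = refl
      exchange-fixed true  {just i}  m≢a m≢b = cong just (transpose-fixed (m≢a ∘ cong just) (m≢b ∘ cong just))
      exchange-fixed false           _   _   = refl

      exchange-injective : ∀ s {m m′ i} → exchange s m ≡ just i → exchange s m′ ≡ just i → m ≡ m′
      exchange-injective true {just _} {just _} e e′ =
          cong just (transpose-injective a b (just-injective (trans e (≡-sym e′))))
      exchange-injective false e e′ = trans e (≡-sym e′)

      exchange-boundary : ∀ {x y} → S x ≡ true → S y ≡ false → colour c x y ≢ just a × colour c x y ≢ just b
      exchange-boundary {x} {y} Sx ¬Sy = (λ e → leaves (inj₁ e)) , (λ e → leaves (inj₂ e))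
        where
        leaves : ¬ (colour c x y ≡ just a ⊎ colour c x y ≡ just b)
        leaves e = true≢false (trans (≡-sym (closed Sx (bichromatic-complete c a b e))) ¬Sy)

      changed : EdgeColouring G k
      changed .colour x y = exchange (S x) (colour c x y)
      changed .colour-sym x y with S x in Sx | S y in Sy
      ... | true  | true  = cong (exchange true) (colour-sym c x y)
      ... | false | false = colour-sym c x y
      ... | true  | false with ¬a , ¬b ← exchange-boundary Sx Sy =
        trans (exchange-fixed true ¬a ¬b) (colour-sym c x y)
      ... | false | true with ¬a , ¬b ← exchange-boundary Sy Sx =
        trans (colour-sym c x y) (≡-sym (exchange-fixed true ¬a ¬b))
      changed .support x y = trans (is-just-exchange (S x) (colour c x y)) (support c x y)
        where
        is-just-exchange : ∀ s m → is-just (exchange s m) ≡ is-just m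
        is-just-exchange true  nothing  = refl
        is-just-exchange true  (just _) = refl
        is-just-exchange false _        = refl

      exchange-coloured : ∀ s {m i} → exchange s m ≡ just i → ∃ λ j → m ≡ just j
      exchange-coloured true  {just j} _ = j , refl
      exchange-coloured false {just j} _ = j , refl

      changed-proper : Proper changed
      changed-proper {x} ey ez with _ , cxz ← exchange-coloured (S x) ez =
        proper (trans (exchange-injective (S x) ey ez) cxz) cxz

      changed-missing-inside : ∀ {x} → S x ≡ true → Missing c x a → Missing changed x b
      changed-missing-inside {x} Sx miss {y} e rewrite Sx with colour c x y in cxy
      ... | just i = miss (trans cxy (cong just (transpose-preimage a b (just-injective e))))

      changed-missing-outside : ∀ {x i} → S x ≡ false → Missing c x i → Missing changed x i
      changed-missing-outside Sx miss e rewrite Sx = miss e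

ProperlyColourable : ∀ {n} → Graph n → ℕ → Set
ProperlyColourable G k = ∃ λ (c : EdgeColouring G k) → Proper c

module _ {n k : ℕ} {G : Graph n} {u v : Fin n} (uv : Adj G u v ≡ true) where

  colourDeleted-proper : ∀ (c : EdgeColouring (delete G u v) k) → Proper c → ∀ {i} → Missing c u i →
      Missing c v i → Proper (colourDeleted uv c i)
  colourDeleted-proper c proper {i} miss-u miss-v {x} {y} {z} ey ez
    with sameEdge? u v x y | sameEdge? u v x z
  ... | yes e             | yes e′            = sameEdge-unique e e′
  ... | no _              | no _              = proper ey ez
  ... | yes (inj₁ (refl , _)) | no _          = contradiction (trans ez (≡-sym ey)) miss-u
  ... | yes (inj₂ (refl , _)) | no _          = contradiction (trans ez (≡-sym ey)) miss-v
  ... | no _ | yes (inj₁ (refl , _))          = contradiction (trans ey (≡-sym ez)) miss-u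
  ... | no _ | yes (inj₂ (refl , _))          = contradiction (trans ey (≡-sym ez)) miss-v

  -- If v is not on the a/b-chain of u, exchanging a and b on that chain frees b at u.
  kempe : ∀ (c : EdgeColouring (delete G u v) k) → Proper c → ∀ {a b} → Missing c u a → Missing c v b →
          ProperlyColourable G k ⊎ Reachable (bichromatic c a b) u v
  kempe c proper {a} {b} miss-u miss-v with component (bichromatic c a b) u
  ... | S , sound , complete with S v in Sv
  ...   | true  = inj₂ (sound v Sv)
  ...   | false = inj₁ (colourDeleted uv changed b ,
    colourDeleted-proper changed changed-proper (changed-missing-inside (complete u here) miss-u)
        (changed-missing-outside Sv miss-v))
    where
    open KempeChange c proper a b S (λ {x} {y} Sx xy →
        complete y (reachable-trans (bichromatic c a b) (sound x Sx) (step xy here)))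

  -- One fan step: `uv` takes the colour `γ` of `uy`, and `uy` becomes the uncoloured edge.
  module Shift (c : EdgeColouring (delete G u v) k) (proper : Proper c) {y : Fin n} {γ : Fin k}
      (uy : colour c u y ≡ just γ) (miss-v : Missing c v γ) where

    G-uy : Adj G u y ≡ true
    G-uy = delete-⊆ G u y (coloured⇒adjacent c uy)

    y≢v : y ≢ v
    y≢v refl = contradiction (trans (≡-sym (deleted-uncoloured {G = G} c (inj₁ (refl , refl)))) uy) (λ ())

    shifted : EdgeColouring (delete G u y) k
    shifted .colour = override u y nothing (override u v (just γ) (colour c))
    shifted .colour-sym = override-sym (override u v (just γ) (colour c)) (override-sym (colour c)
        (colour-sym c))
    shifted .support x z with sameEdge? u y x z
    ... | yes _ = refl
    ... | no _  = support (colourDeleted uv c γ) x z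

    shifted-sound : ∀ {x z i} → colour shifted x z ≡ just i →
      ¬ SameEdge u y x z × ((SameEdge u v x z × i ≡ γ) ⊎ (¬ SameEdge u v x z × colour c x z ≡ just i))
    shifted-sound {x} {z} e with sameEdge? u y x z | sameEdge? u v x z
    ... | no ¬uy | yes uv′ = ¬uy , inj₁ (uv′ , ≡-sym (just-injective e))
    ... | no ¬uy | no ¬uv  = ¬uy , inj₂ (¬uv , e)

    shifted-keeps : ∀ {x z i} → i ≢ γ → colour c x z ≡ just i → colour shifted x z ≡ just i
    shifted-keeps {x} {z} i≢γ e with sameEdge? u y x z | sameEdge? u v x z
    ... | yes uy′ | _      =
        contradiction (just-injective (trans (≡-sym e) (trans (colour-sameEdge c uy′) uy))) i≢γ
    ... | no _    | yes uv′ = contradiction (trans (≡-sym (deleted-uncoloured {G = G} c uv′)) e) (λ ())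
    ... | no _    | no _   = e

    shifted-proper : Proper shifted
    shifted-proper {x} {z} {z′} ez ez′ with shifted-sound {x} {z} ez | shifted-sound {x} {z′} ez′
    ... | _ , inj₁ (uv₁ , _) | _ , inj₁ (uv₂ , _) = sameEdge-unique uv₁ uv₂
    ... | _ , inj₂ (_ , e)   | _ , inj₂ (_ , e′)  = proper e e′
    -- At `u` the only old edge of colour `γ` was `uy`, which has lost its colour; at `v` the colour
    -- `γ` was missing.
    ... | _ , inj₁ (inj₁ (refl , _) , refl) | ¬uy , inj₂ (_ , e) =
        contradiction (inj₁ (refl , proper e uy)) ¬uy
    ... | _ , inj₁ (inj₂ (refl , _) , refl) | ¬uy , inj₂ (_ , e) = contradiction e miss-v
    ... | ¬uy , inj₂ (_ , e) | _ , inj₁ (inj₁ (refl , _) , refl) =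
        contradiction (inj₁ (refl , proper e uy)) ¬uy
    ... | ¬uy , inj₂ (_ , e) | _ , inj₁ (inj₂ (refl , _) , refl) = contradiction e miss-v

    shifted-missing : ∀ {x i} → i ≢ γ → Missing c x i → Missing shifted x i
    shifted-missing {x} i≢γ miss {z} e with shifted-sound {x} {z} e
    ... | _ , inj₁ (_ , i≡γ) = i≢γ i≡γ
    ... | _ , inj₂ (_ , e′)  = miss e′

    -- `uy` was the only edge of colour `γ` at `y`.
    shifted-missing-end : Missing shifted y γ
    shifted-missing-end {z} e with shifted-sound {y} {z} e
    ... | _   , inj₁ (inj₁ (refl , _) , _) = adjacent⇒≢ G G-uy refl
    ... | _   , inj₁ (inj₂ (refl , _) , _) = y≢v refl
    ... | ¬uy , inj₂ (_ , e′) = ¬uy (inj₂ (refl , proper e′ (trans (colour-sym c y u) uy)))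

    -- The shift only removes and adds colour `γ`, so chains of two other colours survive.
    shifted-bichromatic : ∀ {a b} → a ≢ γ → b ≢ γ → bichromatic c a b ⊆ᴳ bichromatic shifted a b
    shifted-bichromatic {a} {b} a≢γ b≢γ x z e =
      bichromatic-complete shifted a b {x} {z} (Sum.map (shifted-keeps a≢γ) (shifted-keeps b≢γ)
          (bichromatic-sound c a b e))

-- Invariant of the fan at u: each past end y, whose edge uy now has colour i, was left for an end
-- z that misses i and lies on the α/i-chain of u; the colour π of the last past end is exempt,
-- since its successor is the current end v.
module Fan {n k : ℕ} (G : Graph n) (degree< : ∀ v → degree G v < k) (u : Fin n) (α : Fin k) where

  record State (v : Fin n) : Set where
    field
      uv       : Adj G u v ≡ true
      c        : EdgeColouring (delete G u v) k
      proper   : Proper c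
      u-misses : Missing c u α
      past     : Fin n → Bool
      v∉past   : past v ≡ false
      π        : Fin k
      v-misses : Missing c v π
      trace    : ∀ {y i} → past y ≡ true → colour c u y ≡ just i → i ≢ π →
                 ∃ λ z → past z ≡ true × Missing c z i × Reachable (bichromatic c α i) u z

    -- In `delete G u v` the degree of `v` is at most `k - 2`, so a second colour is missing besides
    -- `π`.
    another-missing : ∃ λ γ → γ ≢ π × Missing c v γ
    another-missing with any? (λ γ → ¬? (γ ≟ π) ×-dec (classDegree (colour c) v γ <? 1))
    ... | yes (γ , γ≢π , lt) = γ , γ≢π , classDegree<1⇒missing c lt
    ... | no none = contradiction (degree< v) (≤⇒≯ (begin
      k                                                          ≡⟨ trans (sum-const k 1) (*-identityʳ k) ⟨
      sum {k} (λ _ → 1)                                          ≤⟨ sum-mono present ⟩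
      sum (λ γ → 𝟙 ⌊ π ≟ γ ⌋ + classDegree (colour c) v γ)
        ≡⟨ ∑-distrib-+ (λ γ → 𝟙 ⌊ π ≟ γ ⌋) (classDegree (colour c) v) ⟩
      sum (λ γ → 𝟙 ⌊ π ≟ γ ⌋) + sum (classDegree (colour c) v)
        ≡⟨ cong₂ _+_ (trans (≡-sym (count≡sum (λ γ → ⌊ π ≟ γ ⌋))) (count-singleton π))
            (sum-classDegree≡degree c v) ⟩
      suc (degree (delete G u v) v)                              ≡⟨ degree-delete G uv (inj₂ (refl , refl)) ⟨
      degree G v                                                 ∎))
      where
      open ≤-Reasoning
      present : ∀ γ → 1 ≤ 𝟙 ⌊ π ≟ γ ⌋ + classDegree (colour c) v γ
      present γ with π ≟ γ
      ... | yes _  = s≤s z≤n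
      ... | no π≢γ = ≮⇒≥ (λ lt → none (γ , π≢γ ∘ ≡-sym , lt))

  -- If no Kempe change succeeds, `v` lies on the `α`/`π`-chain of `u`. A second missing colour `γ`
  -- then colours `uv`, leads to a new end, or belongs to a past end. The number of vertices that
  -- are not past decreases.
  fan : ∀ v (σ : State v) → Acc _<_ (count (not ∘ State.past σ)) → ProperlyColourable G k
  fan v σ (acc rec) with kempe (State.uv σ) (State.c σ) (State.proper σ) (State.u-misses σ)
      (State.v-misses σ) | State.another-missing σ
  ... | inj₁ done | _ = done
  ... | inj₂ u⇝v  | γ , γ≢π , v-misses-γ with any? (λ y → ≡-dec _≟_ (colour (State.c σ) u y) (just γ))
  ...   | no unused = colourDeleted (State.uv σ) (State.c σ) γ ,
    λ {x} → colourDeleted-proper (State.uv σ) (State.c σ) (State.proper σ) (λ e →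
        unused (_ , e)) v-misses-γ {x}
  ...   | yes (y , uy) with toSum (State.past σ y Bool.≟ true)
  ...     | inj₂ y∉past = fan y next (rec (add-smaller v (State.past σ) (State.v∉past σ)))
    where
    open State σ
    open Shift uv c proper uy v-misses-γ
    α≢γ : α ≢ γ
    α≢γ refl = u-misses uy
    past′ : Fin n → Bool
    past′ = add v past
    past′⇒past : ∀ {w} → past′ w ≡ true → w ≢ v → past w ≡ true
    past′⇒past e w≢v with add-inv v past e
    ... | inj₁ v≡w    = contradiction (≡-sym v≡w) w≢v
    ... | inj₂ w∈past = w∈past
    next : State y
    next .State.uv       = G-uy
    next .State.c        = shifted
    next .State.proper {x} {z} {z′} = shifted-proper {x} {z} {z′}
    next .State.u-misses = shifted-missing α≢γ u-misses
    next .State.past     = past′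
    next .State.v∉past   = ¬-not (λ e → y∉past (past′⇒past e y≢v))
    next .State.π        = γ
    next .State.v-misses = shifted-missing-end
    next .State.trace {w} {i} w∈past′ uw i≢γ with shifted-sound {u} {w} uw
    ... | _ , inj₁ (_ , i≡γ) = contradiction i≡γ i≢γ
    ... | _ , inj₂ (¬uv , cuw) with toSum (i ≟ π)
    -- The colour `π` is no longer exempt. Its witness is `v`, which misses `π` and lies on the
    -- `α`/`π`-chain because the first Kempe change failed.
    ...   | inj₁ refl = v , add-new v past , shifted-missing i≢γ v-misses , reachable-⊆
        (shifted-bichromatic α≢γ i≢γ) u⇝v
    ...   | inj₂ i≢π with z , z∈past , miss , u⇝z ← trace (past′⇒past w∈past′ (λ { refl →
        ¬uv (inj₁ (refl , refl)) })) cuw i≢π =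
      z , add-old v past z∈past , shifted-missing i≢γ miss , reachable-⊆ (shifted-bichromatic α≢γ i≢γ) u⇝z
  ...     | inj₁ y∈past
    with kempe (State.uv σ) (State.c σ) (State.proper σ) (State.u-misses σ) v-misses-γ | State.trace
        σ y∈past uy γ≢π
  ...       | inj₁ done | _ = done
  -- The `α`/`γ`-chain of `u` contains `v` and the recorded `z`. Each of the three misses one of the
  -- two colours and is thus an end of one path, yet `v` is not past and so differs from `z`.
  ...       | inj₂ u⇝v′ | z , z∈past , z-misses-γ , u⇝z = contradiction
    (leaf-partner-unique (bichromatic c α γ) (bichromatic-thin c proper α γ)
      (missing-left⇒leaf c proper α γ u-misses) (missing-right⇒leaf c proper α γ v-misses-γ)
          (missing-right⇒leaf c proper α γ z-misses-γ)
      (adjacent⇒≢ G uv ∘ ≡-sym) z≢u u⇝v′ u⇝z)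
    (λ { refl → true≢false (trans (≡-sym z∈past) v∉past) })
    where
    open State σ
    z≢u : z ≢ u
    z≢u refl = z-misses-γ uy

-- There are more colours than the maximum degree, so both ends of the new edge miss one, and a fan
-- can start without past ends.
vizing : ∀ {n} (G : Graph n) k → (∀ v → degree G v < k) → Colourable G k 1
vizing {n} G k degree< = defect-1 (edge-induction P base insert G (λ _ _ e → e))
  where
  P : Graph n → Set
  P H = H ⊆ᴳ G → ProperlyColourable H k
  defect-1 : ProperlyColourable G k → Colourable G k 1
  defect-1 (c , proper) = c , proper⇒defect-1 {c = c} proper
  base : ∀ H → Edgeless H → P H
  base H edgeless _ = emptyColouring edgeless , λ ()
  insert : ∀ H u v → Adj H u v ≡ true → P (delete H u v) → P H
  insert H u v uv ih H⊆G with ih (λ x y e → H⊆G x y (delete-⊆ H x y e))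
  ... | c , proper = start (free-colour c u (small (inj₁ (refl , refl))))
      (free-colour c v (small (inj₂ (refl , refl))))
    where
    degree<ᴴ : ∀ x → degree H x < k
    degree<ᴴ x = ≤-<-trans (degree-⊆ {H = H} {G} H⊆G x) (degree< x)
    small : ∀ {x y} → SameEdge u v x y → degree (delete H u v) x < k * 1
    small {x} e = ≤-trans (≤-reflexive (≡-sym (degree-delete H uv e))) (≤-trans (<⇒≤ (degree<ᴴ x))
        (≤-reflexive (≡-sym (*-identityʳ k))))
    start : (∃ λ i → classDegree (colour c) u i < 1) → (∃ λ i → classDegree (colour c) v i < 1) →
        ProperlyColourable H k
    start (α , free-u) (π , free-v) = Fan.fan H degree<ᴴ u α v record
      { uv       = uv
      ; c        = c
      ; proper   = proper
      ; u-misses = classDegree<1⇒missing c free-u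
      ; past     = λ _ → false
      ; v∉past   = refl
      ; π        = π
      ; v-misses = classDegree<1⇒missing c free-v
      ; trace    = λ ()
      } (<-wellFounded _)

-- Defect colourings

-- `i₀` fills in the values on non-edges.
toDefectColouring : ∀ {n d k} {G : Graph n} → Fin k → Colourable G k d → DefectColouring G d k
toDefectColouring i₀ (c , defect) .DefectColouring.col x y = fromMaybe i₀ (colour c x y)
toDefectColouring i₀ (c , defect) .DefectColouring.col-sym x y _ = cong (fromMaybe i₀) (colour-sym c x y)
toDefectColouring {G = G} i₀ (c , defect) .DefectColouring.defect x i =
    ≤-trans (count-mono class) (defect x i)
  where
  class : ∀ y → Adj G x y ∧ ⌊ fromMaybe i₀ (colour c x y) ≟ i ⌋ ≡ true → hasColour (colour c x y) i ≡ true
  class y e with colour c x y | support c x y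
  ... | just _  | s rewrite ≡-sym s = e
  ... | nothing | s rewrite ≡-sym s = e

module _ {n d k : ℕ} {G : Graph n} (δ : DefectColouring G d k) where
  open DefectColouring δ

  fromDefectColouring : EdgeColouring G k
  fromDefectColouring .colour x y = if Adj G x y then just (col x y) else nothing
  fromDefectColouring .colour-sym x y with Adj G x y in xy | Adj G y x | Graph.sym G x y
  ... | true  | true  | _ = cong just (col-sym x y xy)
  ... | false | false | _ = refl
  fromDefectColouring .support x y with Adj G x y
  ... | true  = refl
  ... | false = refl

  fromDefectColouring-defect : HasDefect fromDefectColouring d
  fromDefectColouring-defect x i = ≤-trans (≤-reflexive (count-cong class)) (defect x i)
    where
    class : ∀ y → hasColour (if Adj G x y then just (col x y) else nothing) i ≡ Adj G x y ∧ ⌊ col x y ≟ i ⌋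
    class y with Adj G x y
    ... | true  = refl
    ... | false = refl

  -- Source of the lower bounds: the edges at `x` fall into `k` classes of at most `d` edges each.
  degree≤colours*defect : ∀ x → degree G x ≤ k * d
  degree≤colours*defect x = begin
    degree G x                                          ≡⟨ sum-classDegree≡degree fromDefectColouring x ⟨
    sum (classDegree (colour fromDefectColouring) x)    ≤⟨ sum-mono (fromDefectColouring-defect x) ⟩
    sum {k} (λ _ → d)                                   ≡⟨ sum-const k d ⟩
    k * d                                               ∎
    where open ≤-Reasoning

monochromatic : ∀ {n k} (G : Graph n) → Fin k → EdgeColouring G k
monochromatic G i .colour x y = if Adj G x y then just i else nothing
monochromatic G i .colour-sym x y = cong (λ b → if b then just i else nothing) (Graph.sym G x y)
monochromatic G i .support x y with Adj G x y
... | true  = refl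
... | false = refl

classDegree≤degree : ∀ {n k} {G : Graph n} (c : EdgeColouring G k) x i →
    classDegree (colour c) x i ≤ degree G x
classDegree≤degree {n} {G = G} c x i = count-mono {n} {q = Adj G x} (λ y e →
    coloured⇒adjacent c (hasColour-sound e))

-- A new class is a union of `d` matchings, which has at most `d` edges at any vertex.
group-colours : ∀ {n} {G : Graph n} d k → Colourable G (k * d) 1 →
                Colourable G k d
group-colours {n} {G} d k (c , proper) = grouped , defect
  where
  is-just-map : ∀ m → is-just (Maybe.map (quotient {k} d) m) ≡ is-just m
  is-just-map nothing  = refl
  is-just-map (just _) = refl
  grouped : EdgeColouring G k
  grouped .colour x y     = Maybe.map (quotient d) (colour c x y)
  grouped .colour-sym x y = cong (Maybe.map (quotient d)) (colour-sym c x y)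
  grouped .support x y    = trans (is-just-map (colour c x y)) (support c x y)
  member : ∀ m i → 𝟙 (hasColour (Maybe.map (quotient {k} d) m) i) ≤ sum {d} (λ r →
      𝟙 (hasColour m (combine i r)))
  member nothing i = z≤n
  member (just j) i with quotient {k} d j ≟ i
  ... | no _     = z≤n
  -- The old colour `j` is recovered from its block and its remainder.
  ... | yes refl = ≤-trans (count-pos (remainder {k} d j) (⌊⌋-true (j ≟ _) (≡-sym (combine-remQuot {k} d j))))
                     (≤-reflexive (count≡sum {d} (λ r → ⌊ j ≟ combine i r ⌋)))
  defect : HasDefect grouped d
  defect x i = begin
    classDegree (colour grouped) x i
      ≡⟨ count≡sum (λ y → hasColour (colour grouped x y) i) ⟩
    sum (λ y → 𝟙 (hasColour (colour grouped x y) i))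
      ≤⟨ sum-mono (λ y → member (colour c x y) i) ⟩
    sum (λ y → sum {d} (λ r → 𝟙 (hasColour (colour c x y) (combine i r))))
      ≡⟨ ∑-comm (λ y (r : Fin d) → 𝟙 (hasColour (colour c x y) (combine i r))) ⟩
    sum {d} (λ r → sum (λ y → 𝟙 (hasColour (colour c x y) (combine i r))))
      ≡⟨ sum-cong-≗ {d} (λ r → count≡sum (λ y → hasColour (colour c x y) (combine i r))) ⟨
    sum {d} (λ r → classDegree (colour c) x (combine i r))
      ≤⟨ sum-mono (λ r → proper x (combine i r)) ⟩
    sum {d} (λ _ → 1)
      ≡⟨ trans (sum-const d 1) (*-identityʳ d) ⟩
    d                                                                  ∎
    where open ≤-Reasoning

vizing-defect : ∀ {n} (G : Graph n) d k → (∀ v → degree G v < k * d) → Colourable G k d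
vizing-defect G d k degree< = group-colours d k (vizing G (k * d) degree<)

count-lookup : ∀ {n} (S : Subset n) → count (lookup S) ≡ ∣ S ∣
count-lookup S = cong ∣_∣ (tabulate∘lookup S)

regularComponentsEven⇒componentsEven : ∀ {n} (G : Graph n) d → RegularComponentsEven G (2 * d) →
    ComponentsEven G d
regularComponentsEven⇒componentsEven G d even v S sound complete regular =
  ∣n⇒∣m*n d (even v (λ w p → regular w (complete w p)) (tabulate S) λ w →
    mk⇔ (λ w∈S → sound w (trans (≡-sym (lookup∘tabulate S w)) ([]=⇒lookup w∈S)))
        (λ p → lookup⇒[]= w (tabulate S) (trans (lookup∘tabulate S w) (complete w p))))

-- In a 2d-regular component both classes are d-regular, so d|S| is even by the handshake lemma.
two-colourable⇒regularComponentsEven : ∀ {n} (G : Graph n) d → ¬ Even d → (∀ v → degree G v ≤ 2 * d) →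
  DefectColouring G d 2 → RegularComponentsEven G (2 * d)
two-colourable⇒regularComponentsEven {n} G d odd degree≤ δ v regular S S⇔ =
  Sum.[ (λ even → even) , (λ even → contradiction even odd) ]′ (euclidsLemma ∣ S ∣ d prime[2]
      (subst Even total (class-handshake c zero (lookup S) closed)))
  where
  open TwoColours G d degree≤
  c : EdgeColouring G 2
  c = fromDefectColouring δ
  reachable : ∀ {w} → lookup S w ≡ true → Reachable G v w
  reachable {w} Sw = Equivalence.to (S⇔ w) (lookup⇒[]= w S Sw)
  closed : Closed (lookup S)
  closed {x} {y} Sx xy = []=⇒lookup (Equivalence.from (S⇔ y) (reachable-trans G (reachable Sx)
      (step xy here)))
  exact : ∀ x → 𝟙 (lookup S x) * classSize c x zero ≡ 𝟙 (lookup S x) * d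
  exact x with lookup S x in Sx
  ... | true  = cong (1 *_) (saturated c (regular x (reachable Sx))
      (fromDefectColouring-defect δ x zero) (fromDefectColouring-defect δ x (suc zero)))
  ... | false = refl
  total : sum (λ x → 𝟙 (lookup S x) * classSize c x zero) ≡ ∣ S ∣ * d
  total = trans (sum-cong-≗ exact) (trans (≡-sym (*-distribʳ-sum d (𝟙 ∘ lookup S)))
            (cong (_* d) (trans (≡-sym (count≡sum (lookup S))) (count-lookup S))))

-- Ceilings of quotients.

module _ (Δ d : ℕ) .{{_ : NonZero d}} where

  private
    d-1<d : d ∸ 1 < d
    d-1<d = ≤-reflexive (m+[n∸m]≡n (>-nonZero⁻¹ d))

  -- `Δ + (d ∸ 1)` is below `suc k * d`, so its quotient by `d` is below `suc k`.
  ⌈/⌉-least : ∀ {k} → Δ ≤ k * d → ⌈ Δ / d ⌉ ≤ k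
  ⌈/⌉-least {k} le = s≤s⁻¹ (m<n*o⇒m/o<n {n = suc k} (subst (Δ + (d ∸ 1) <_) (+-comm (k * d) d)
      (+-mono-≤-< le d-1<d)))

  -- The remainder of `Δ + (d ∸ 1)` modulo `d` is at most `d ∸ 1`, which leaves at least `Δ` for the
  -- multiple of `d`.
  ⌈/⌉-upper : Δ ≤ ⌈ Δ / d ⌉ * d
  ⌈/⌉-upper = +-cancelʳ-≤ (d ∸ 1) _ _ (begin
    Δ + (d ∸ 1)                                      ≡⟨ m≡m%n+[m/n]*n (Δ + (d ∸ 1)) d ⟩
    (Δ + (d ∸ 1)) % d + ⌈ Δ / d ⌉ * d
      ≤⟨ +-monoˡ-≤ _ (s≤s⁻¹ (≤-trans (m%n<n (Δ + (d ∸ 1)) d)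
          (≤-reflexive (≡-sym (m+[n∸m]≡n (>-nonZero⁻¹ d)))))) ⟩
    d ∸ 1 + ⌈ Δ / d ⌉ * d                            ≡⟨ +-comm (d ∸ 1) _ ⟩
    ⌈ Δ / d ⌉ * d + (d ∸ 1)                          ∎)
    where open ≤-Reasoning

-- The minimum number of colours.

module _ (d Δ : ℕ) .{{_ : NonZero d}} (1≤Δ : 1 ≤ Δ) {n : ℕ} (G : Graph n) (maxDegree : MaxDegree G Δ) where
  private
    degree≤ : ∀ v → degree G v ≤ Δ
    degree≤ = proj₁ maxDegree
    v₀ : Fin n
    v₀ = proj₁ (proj₂ maxDegree)
    degree-v₀ : degree G v₀ ≡ Δ
    degree-v₀ = proj₂ (proj₂ maxDegree)

  Δ≤colours*defect : ∀ {k} → DefectColouring G d k → Δ ≤ k * d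
  Δ≤colours*defect δ = ≤-trans (≤-reflexive (≡-sym degree-v₀)) (degree≤colours*defect δ v₀)

  -- As `Δ` is at least 1, there is an edge at `v₀`, and its colour becomes the default on
  -- non-edges.
  defectColouring : ∀ {k} → Colourable G k d → DefectColouring G d k
  defectColouring (c , defect) with y , adjacent ← count-pos⁻ {p = Adj G v₀}
      (subst (1 ≤_) (≡-sym degree-v₀) 1≤Δ) =
    toDefectColouring (proj₁ (adjacent⇒coloured c {v₀} {y} adjacent)) (c , defect)

  chi-ceiling : (¬ (d ∣ Δ)) ⊎ (Even d ⊎ Δ ≡ d) → ChiDefect G d ⌈ Δ / d ⌉
  chi-ceiling cases = colouring cases , λ k δ → ⌈/⌉-least Δ d (Δ≤colours*defect δ)
    where
    k : ℕ
    k = ⌈ Δ / d ⌉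
    Δ≤kd : Δ ≤ k * d
    Δ≤kd = ⌈/⌉-upper Δ d
    first : ∀ {k} → Δ ≤ k * d → Fin k
    first {zero}  le = contradiction (≤-trans 1≤Δ le) λ ()
    first {suc _} le = zero
    colouring : (¬ (d ∣ Δ)) ⊎ (Even d ⊎ Δ ≡ d) → DefectColouring G d k
    -- Non-divisibility makes `Δ ≤ k * d` strict, which provides the extra colour for Vizing's
    -- theorem.
    colouring (inj₁ d∤Δ) = defectColouring (vizing-defect G d k
      (λ v → ≤-<-trans (degree≤ v) (≤∧≢⇒< Δ≤kd (λ Δ≡kd → d∤Δ (divides k Δ≡kd)))))
    colouring (inj₂ (inj₁ even)) = defectColouring (even-defect-colouring G d k even (λ v →
        ≤-trans (degree≤ v) Δ≤kd))
    -- A single class can hold all edges when `Δ ≡ d`; `k` is positive because `Δ` is.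
    colouring (inj₂ (inj₂ Δ≡d))  = defectColouring (c , λ v i →
      ≤-trans (classDegree≤degree c v i) (≤-trans (degree≤ v) (≤-reflexive Δ≡d)))
      where
      c : EdgeColouring G k
      c = monochromatic G (first {k} Δ≤kd)

  module _ (odd : ¬ Even d) (Δ≡2d : Δ ≡ 2 * d) where
    private
      degree≤2d : ∀ v → degree G v ≤ 2 * d
      degree≤2d v = ≤-trans (degree≤ v) (≤-reflexive Δ≡2d)

    2≤colours : ∀ k → DefectColouring G d k → 2 ≤ k
    2≤colours k δ = *-cancelʳ-≤ 2 k d (≤-trans (≤-reflexive (≡-sym Δ≡2d)) (Δ≤colours*defect δ))

    chi-two : ChiDefect G d 2 ⇔ RegularComponentsEven G (2 * d)
    chi-two = mk⇔ (λ chi → two-colourable⇒regularComponentsEven G d odd degree≤2d (proj₁ chi))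
      (λ even → defectColouring (two-colouring G d degree≤2d
          (regularComponentsEven⇒componentsEven G d even)) , 2≤colours)

    -- All degrees are below `3 * d`, so Vizing's theorem applies with `3 * d` colours. At least two
    -- colours are needed, and exactly two would force even regular components.
    chi-three : ¬ RegularComponentsEven G (2 * d) → ChiDefect G d 3
    chi-three uneven = defectColouring (vizing-defect G d 3 (λ v →
        ≤-<-trans (degree≤2d v) (*-monoˡ-< d (≤-refl {3})))) ,
      λ k δ → ≤∧≢⇒< (2≤colours k δ) (λ { refl →
          uneven (two-colourable⇒regularComponentsEven G d odd degree≤2d δ) })

theorem11p4p4 : (d Δ : ℕ) .{{_ : NonZero d}} → 1 ≤ Δ →
    ∀ {n} (G : Graph n) → MaxDegree G Δ →
    (((¬ (d ∣ Δ)) ⊎ (Even d ⊎ Δ ≡ d)) → ChiDefect G d ⌈ Δ / d ⌉)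
    × ((¬ Even d) → Δ ≡ 2 * d →
    (ChiDefect G d 2 ⇔ RegularComponentsEven G (2 * d))
    × ((¬ RegularComponentsEven G (2 * d)) → ChiDefect G d 3))
theorem11p4p4 d Δ 1≤Δ G maxDegree =
  chi-ceiling d Δ 1≤Δ G maxDegree ,
  λ odd Δ≡2d → chi-two d Δ 1≤Δ G maxDegree odd Δ≡2d , chi-three d Δ 1≤Δ G maxDegree odd Δ≡2d
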